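{- Let $\mathbb{k}$ be a commutative ring, $n\ge0$, and $\alpha$ a composition of $n$. Then in $\mathbb{k}S_n$, \[ w_0B_\alpha\prod_{\substack{k\in n_\alpha(\Sigma_n)\\ k\neq0}}(w_0B_\alpha+k)(w_0B_\alpha-k)=0, \] the product ranging over the distinct nonzero elements of $n_\alpha(\Sigma_n)$.
   Context: $[n]=\{1,\ldots,n\}$; $S_n$ the symmetric group with $(\sigma\tau)(i)=\sigma(\tau(i))$, $\mathbb{k}S_n$ its group algebra, $w_0(i)=n+1-i$. For a composition $\alpha=(\alpha_1,\ldots,\alpha_k)$ of $n$ let $D(\alpha)=\{\alpha_1,\ldots,\alpha_1+\cdots+\alpha_{k-1}\}$ and $B_\alpha=\sum_{w\in S_n:\operatorname{Des}w\subseteq D(\alpha)}w$, where $\operatorname{Des}w=\{i\in[n-1]:w(i)>w(i+1)\}$. A set composition of $[n]$ is a tuple $F=(F_1,\ldots,F_m)$ of nonempty pairwise disjoint sets with union $[n]$, of type $(|F_1|,\ldots,|F_m|)$; $\Sigma_n$ is the set of all of them. $F\preceq G$ means each block of $F$ lies in some block of $G$. $n_\alpha(F)=\#\{G\in\Sigma_n:F\preceq G,\ \operatorname{type}G=\alpha\}$ and $n_\alpha(\Sigma_n)=\{n_\alpha(F):F\in\Sigma_n\}$. -}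

module Defs where

open import Level using (Level)
open import Data.Bool using (Bool; true; false; if_then_else_; _∧_; not)
open import Data.Nat as ℕ using (ℕ; zero; suc; _<_; _<ᵇ_; _≡ᵇ_)
open import Data.Bool.ListAction using (any; all)
open import Data.Nat.ListAction using (sum)
open import Data.Fin as Fin using (Fin; toℕ; opposite)
open import Data.Fin.Properties using (_≟_)
open import Data.List as List using (List; []; _∷_; [_]; _++_; map; concatMap; filterᵇ;
  length; foldr; upTo; deduplicate; allFin)
open import Data.List.Relation.Unary.All using (All)
open import Data.Vec as Vec using (Vec; lookup; tabulate; toList)
open import Data.Product using (Σ; _×_; _,_; proj₁; proj₂)
open import Relation.Nullary.Decidable using (does)
open import Relation.Binary.PropositionalEquality using (_≡_)
open import Algebra.Bundles using (CommutativeRing)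

allVecs : {A : Set} → List A → (m : ℕ) → List (Vec A m)
allVecs xs zero    = Vec.[] ∷ []
allVecs xs (suc m) = concatMap (λ x → map (x Vec.∷_) (allVecs xs m)) xs

_==_ : {n : ℕ} → Fin n → Fin n → Bool
i == j = does (i ≟ j)

vecEqᵇ : {n m : ℕ} → Vec (Fin n) m → Vec (Fin n) m → Bool
vecEqᵇ Vec.[] Vec.[] = true
vecEqᵇ (x Vec.∷ xs) (y Vec.∷ ys) = (x == y) ∧ vecEqᵇ xs ys

distinctᵇ : {n : ℕ} → List (Fin n) → Bool
distinctᵇ [] = true
distinctᵇ (x ∷ xs) = not (any (x ==_) xs) ∧ distinctᵇ xs

-- The symmetric group S_n.  A permutation w of [n] is stored as its
-- one-line notation  w = (w(1), …, w(n))  with 0-based values/positions: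
-- w(i+1) - 1 = lookup w i.

Word : ℕ → Set
Word n = Vec (Fin n) n

allPerms : (n : ℕ) → List (Word n)
allPerms n = filterᵇ (λ w → distinctᵇ (toList w)) (allVecs (allFin n) n)

idPerm : (n : ℕ) → Word n
idPerm n = tabulate (λ i → i)

w₀ : (n : ℕ) → Word n
w₀ n = tabulate opposite

_∘ₚ_ : {n : ℕ} → Word n → Word n → Word n
σ ∘ₚ τ = Vec.map (lookup σ) τ

-- Des w as 1-based positions: descents i (a ∷ b ∷ r) lists i if a > b, …
descents : ℕ → List ℕ → List ℕ
descents i [] = []
descents i (a ∷ []) = []
descents i (a ∷ b ∷ r) =
  if b <ᵇ a then i ∷ descents (suc i) (b ∷ r) else descents (suc i) (b ∷ r)

Des : {n : ℕ} → Word n → List ℕ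
Des w = descents 1 (toList (Vec.map toℕ w))

IsComposition : ℕ → List ℕ → Set
IsComposition n α = All (0 <_) α × sum α ≡ n

partialSums : ℕ → List ℕ → List ℕ
partialSums acc [] = []
partialSums acc (a ∷ []) = []
partialSums acc (a ∷ b ∷ r) = (acc ℕ.+ a) ∷ partialSums (acc ℕ.+ a) (b ∷ r)

D : List ℕ → List ℕ
D α = partialSums 0 α

_∈ᵇ_ : ℕ → List ℕ → Bool
x ∈ᵇ xs = any (x ≡ᵇ_) xs

DesSubset : {n : ℕ} → List ℕ → Word n → Bool
DesSubset α w = all (_∈ᵇ D α) (Des w)

-- Set compositions of [n].  A set composition (F₁,…,F_m) is encoded by
-- the map f : [n] → [m] sending x to the index of its block (as a word
-- of length n over Fin m); the blocks are nonempty iff f is surjective.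

SetCompWord : ℕ → ℕ → Set
SetCompWord n m = Vec (Fin m) n

surjectiveᵇ : {n m : ℕ} → SetCompWord n m → Bool
surjectiveᵇ {m = m} f = all (λ j → any (j ==_) (toList f)) (allFin m)

Σₙ : (n : ℕ) → List (Σ ℕ (SetCompWord n))
Σₙ n = concatMap (λ m → map (m ,_) (filterᵇ surjectiveᵇ (allVecs (allFin m) n)))
                 (upTo (suc n))

refinesᵇ : {n m k : ℕ} → SetCompWord n m → SetCompWord n k → Bool
refinesᵇ {n} f g =
  all (λ x → all (λ y → not (lookup f x == lookup f y) Data.Bool.∨
                          (lookup g x == lookup g y)) (allFin n)) (allFin n)

typeOf : {n k : ℕ} → SetCompWord n k → List ℕ
typeOf {k = k} g = map (λ j → length (filterᵇ (j ==_) (toList g))) (allFin k)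

listEqᵇ : List ℕ → List ℕ → Bool
listEqᵇ [] [] = true
listEqᵇ (x ∷ xs) (y ∷ ys) = (x ≡ᵇ y) ∧ listEqᵇ xs ys
listEqᵇ _ _ = false

-- n_α(F) = #{G ∈ Σ_n : F ⪯ G, type G = α}
-- (a set composition of type α has exactly length α blocks)
nα : {n m : ℕ} → List ℕ → SetCompWord n m → ℕ
nα {n} α f = length (filterᵇ (λ g → refinesᵇ f g ∧ listEqᵇ (typeOf g) α)
                             (allVecs (allFin (length α)) n))

nonzeroValues : (n : ℕ) → List ℕ → List ℕ
nonzeroValues n α =
  filterᵇ (λ k → not (k ≡ᵇ 0))
          (deduplicate ℕ._≟_ (map (λ F → nα α (proj₂ F)) (Σₙ n)))

-- The group algebra k S_n, elements as finite formal sums Σ a_i σ_i,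
-- compared coefficientwise.

module GroupAlgebra {c ℓ : Level} (R : CommutativeRing c ℓ) (n : ℕ) where
  open CommutativeRing R

  KS : Set c
  KS = List (Carrier × Word n)

  coeff : KS → Word n → Carrier
  coeff x v = foldr (λ p acc → (if vecEqᵇ (proj₂ p) v then proj₁ p else 0#) + acc) 0# x

  _≈ᴷ_ : KS → KS → Set ℓ
  x ≈ᴷ y = (v : Word n) → coeff x v ≈ coeff y v

  0ᴷ : KS
  0ᴷ = []

  1ᴷ : KS
  1ᴷ = (1# , idPerm n) ∷ []

  _+ᴷ_ : KS → KS → KS
  x +ᴷ y = x ++ y

  -ᴷ_ : KS → KS
  -ᴷ x = map (λ p → (- proj₁ p , proj₂ p)) x

  _-ᴷ_ : KS → KS → KS
  x -ᴷ y = x +ᴷ (-ᴷ y)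

  _*ᴷ_ : KS → KS → KS
  x *ᴷ y = concatMap (λ p → map (λ q → (proj₁ p * proj₁ q , proj₂ p ∘ₚ proj₂ q)) y) x

  ⟦_⟧ : Word n → KS
  ⟦ w ⟧ = (1# , w) ∷ []

  natR : ℕ → Carrier
  natR zero = 0#
  natR (suc k) = 1# + natR k

  nat : ℕ → KS
  nat k = (natR k , idPerm n) ∷ []

  prodᴷ : List KS → KS
  prodᴷ = foldr _*ᴷ_ 1ᴷ

  B : List ℕ → KS
  B α = map (λ w → (1# , w)) (filterᵇ (DesSubset α) (allPerms n))

  w₀B : List ℕ → KS
  w₀B α = ⟦ w₀ n ⟧ *ᴷ B α

  theoremLHS : List ℕ → KS
  theoremLHS α =
    w₀B α *ᴷ prodᴷ (map (λ k → (w₀B α +ᴷ nat k) *ᴷ (w₀B α -ᴷ nat k))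
                        (nonzeroValues n α))

{-# OPTIONS --safe #-}

-- Let y = w₀ B_α.  On chambers C (linear orders on [n]), right multiplication by y is
-- C ↦ Σ_G G·(−C), where G runs over the set compositions of type α, · is the product of
-- set compositions and − reverses the order of the blocks.  As −(G·C) = (−G)·(−C), the powers
-- of y expand into products G₁·(−G₂)·G₃·⋯ , which are built up from the left by
-- (F , s) ↦ Σ_G (F·sG , −s), starting from the set composition F with a single block.
-- If F ⪯ G then F·sG = F; otherwise F·sG has strictly more coarsenings of type α than F has.
-- So this operator Y satisfies (F , s)·Y = n_α(F) (F , −s) + higher terms: modulo higher
-- terms Y² − k² vanishes on the F with n_α(F) = k, and Y itself when k = 0.  The
-- factors commute, hence their product over all values k of n_α annihilates everything.

module Submission where

open import Defs
open import Level using (Level)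
open import Algebra.Bundles using (CommutativeRing)
import Algebra.Properties.CommutativeSemigroup
import Algebra.Properties.Ring
open import Data.Bool using (Bool; true; false; T; not; _∧_; _∨_; if_then_else_)
open import Data.Bool.ListAction using (any; all; and)
open import Data.Bool.Properties using (T-∧; T-∨; T?; ∧-comm; not-involutive)
open import Data.Empty using (⊥-elim)
open import Data.Fin using (Fin; zero; suc; toℕ; punchOut; fromℕ<; opposite; splitAt; _↑ˡ_; _↑ʳ_;
  combine)
open import Data.Fin.Properties using (_≟_; any?; punchOut-injective; suc-injective;
  <⇒notInjective; toℕ-injective; toℕ-fromℕ<; fromℕ<-injective; toℕ<n; opposite-prop;
  opposite-involutive; toℕ-↑ˡ; toℕ-↑ʳ; splitAt⁻¹-↑ˡ; splitAt⁻¹-↑ʳ; splitAt-↑ˡ; splitAt-↑ʳ;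
  combine-monoˡ-<; combine-injective; toℕ-combine)
open import Data.List as List using (List; []; _∷_; _++_; map; concatMap; filterᵇ; length; allFin;
  cartesianProductWith)
open import Data.List.Membership.Propositional using (_∈_; lose)
open import Data.List.Membership.Propositional.Properties using (∈-allFin; ∈-map⁺; ∈-map⁻;
  ∈-cartesianProductWith⁺; ∈-filter⁺; ∈-filter⁻; ∈-concatMap⁺; ∈-deduplicate⁺; ∈-upTo⁺; ∈-∃++;
  ∈-++⁺ˡ; ∈-++⁺ʳ; ∈-++⁻)
open import Data.List.Membership.Propositional.Properties.WithK using (unique∧set⇒bag)
open import Data.List.Properties using (map-tabulate; length-tabulate; length-filter; map-cong;
  tabulate-lookup; ∷-injective)
open import Data.List.Relation.Binary.BagAndSetEquality using (∼bag⇒↭)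
open import Data.List.Relation.Binary.Permutation.Propositional as Perm using (_↭_)
open import Data.List.Relation.Binary.Permutation.Propositional.Properties using (filter-↭;
  ↭-length)
open import Data.List.Relation.Unary.All as All using (All; []; _∷_)
import Data.List.Relation.Unary.All.Properties as All
import Data.List.Relation.Unary.AllPairs as AllPairs
open import Data.List.Relation.Unary.Any using (here; there)
open import Data.List.Relation.Unary.Unique.Propositional using (Unique)
import Data.List.Relation.Unary.Unique.Propositional.Properties as Unique
open import Data.Nat as ℕ using (ℕ; zero; suc; _≤_; _<_; z≤n; s≤s; _≤ᵇ_; _≡ᵇ_; _<ᵇ_)
open import Data.Nat.ListAction using (sum)
import Data.Nat.Properties as ℕ
open import Data.Product using (∃; _×_; _,_; proj₁; proj₂)
open import Data.Sum using (_⊎_; inj₁; inj₂; [_,_]′)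
open import Data.Unit using (tt)
open import Data.Vec as Vec using (Vec; lookup; tabulate; toList)
import Data.Vec.Properties as Vec
open import Function using (_∘_; id; Injective; Equivalence; mk⇔)
open import Relation.Binary.Definitions using (tri<; tri≈; tri>)
open import Relation.Binary.PropositionalEquality using (_≡_; _≢_; _≗_; refl; sym; trans; cong;
  cong₂; subst; subst₂)
import Relation.Binary.Reasoning.Setoid
open import Relation.Nullary using (¬_; yes; no)

-- No module of formal sums of signed faces is built. An element `z` of the group algebra is tested
-- against an arbitrary function `φ` of relations: `hat z F s` pairs `z` with
-- `φ (F ⊙ signed s (ord w))`. With `F` and `s` kept as free arguments, right multiplication of `z`
-- by `w₀B α` becomes the operator `Y` acting on these arguments. Choosing `φ = δ v` recovers the
-- coefficient at `v`. The sign is there because reversing a chamber is not multiplication by a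
-- face: the reversal has to be carried past every face that stands to its left. It also forces the
-- factors to come in pairs, since at its leading order `Y` is `k` times the swap of the two signs,
-- and only the square of that swap is the identity. Faces are ordered by a plain number, their
-- count of coarsenings. One factor therefore serves all faces with the same count at once, which is
-- why each distinct value occurs only once in the product, and the count is bounded, which makes
-- the induction finite. Relations are compared pointwise, so functions of them carry a proof of
-- `Extensional`.

private variable
  A C : Set
  m n : ℕ

-- Booleans, enumerations and counting

T-ext : ∀ {a b} → (T a → T b) → (T b → T a) → a ≡ b
T-ext {false} {false} f g = refl
T-ext {false} {true}  f g = ⊥-elim (g tt)
T-ext {true}  {false} f g = ⊥-elim (f tt)
T-ext {true}  {true}  f g = refl

T-∧⁺ : ∀ {a b} → T a → T b → T (a ∧ b)
T-∧⁺ p q = Equivalence.from T-∧ (p , q)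

T-∧⁻ : ∀ {a b} → T (a ∧ b) → T a × T b
T-∧⁻ = Equivalence.to T-∧

T-not⁻ : ∀ {a} → T (not a) → ¬ T a
T-not⁻ {false} _ ()

T-not⁺ : ∀ {a} → ¬ T a → T (not a)
T-not⁺ {false} _ = tt
T-not⁺ {true} h = ⊥-elim (h tt)

==⇒≡ : {i j : Fin n} → T (i == j) → i ≡ j
==⇒≡ {i = i} {j} t with i ≟ j
... | yes p = p

≡⇒== : {i j : Fin n} → i ≡ j → T (i == j)
≡⇒== {i = i} {j} p with i ≟ j
... | yes _ = tt
... | no ¬p = ¬p p

all⁻ : (p : A → Bool) {xs : List A} → T (all p xs) → ∀ {x} → x ∈ xs → T (p x)
all⁻ p t (here refl) = proj₁ (T-∧⁻ t)
all⁻ p {x ∷ _} t (there h) = all⁻ p (proj₂ (T-∧⁻ {p x} t)) h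

all⁺ : (p : A → Bool) (xs : List A) → (∀ {x} → x ∈ xs → T (p x)) → T (all p xs)
all⁺ p [] h = tt
all⁺ p (x ∷ xs) h = T-∧⁺ (h (here refl)) (all⁺ p xs (h ∘ there))

any⁺ : (p : A → Bool) {xs : List A} → ∀ {x} → x ∈ xs → T (p x) → T (any p xs)
any⁺ p (here refl) t = Equivalence.from T-∨ (inj₁ t)
any⁺ p {y ∷ _} (there h) t = Equivalence.from (T-∨ {p y}) (inj₂ (any⁺ p h t))

any⁻ : (p : A → Bool) (xs : List A) → T (any p xs) → ∃ λ x → x ∈ xs × T (p x)
any⁻ p (x ∷ xs) t with Equivalence.to (T-∨ {p x}) t
... | inj₁ h = x , here refl , h
... | inj₂ h with y , y∈ , q ← any⁻ p xs h = y , there y∈ , q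

-- Without repetitions a membership proof is unique, so mutual inclusion is already an equality of
-- bags.
unique-↭ : {xs ys : List A} → Unique xs → Unique ys →
           (∀ {x} → x ∈ xs → x ∈ ys) → (∀ {x} → x ∈ ys → x ∈ xs) → xs ↭ ys
unique-↭ u v f g = ∼bag⇒↭ (unique∧set⇒bag u v (mk⇔ f g))

allVecs-product : (xs : List A) (m : ℕ) →
  allVecs xs (suc m) ≡ cartesianProductWith Vec._∷_ xs (allVecs xs m)
allVecs-product xs m = go xs
  where
  go : ∀ ys → concatMap (λ x → map (x Vec.∷_) (allVecs xs m)) ys
            ≡ cartesianProductWith Vec._∷_ ys (allVecs xs m)
  go []       = refl
  go (y ∷ ys) = cong (map (y Vec.∷_) (allVecs xs m) ++_) (go ys)

allVecs-unique : {xs : List A} → Unique xs → ∀ m → Unique (allVecs xs m)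
allVecs-unique u zero    = All.[] AllPairs.∷ AllPairs.[]
allVecs-unique {xs = xs} u (suc m) rewrite allVecs-product xs m =
  Unique.cartesianProductWith⁺ _ Vec.∷-injective u (allVecs-unique u m)

allVecs-complete : {xs : List A} → (∀ x → x ∈ xs) → (v : Vec A m) → v ∈ allVecs xs m
allVecs-complete c Vec.[] = here refl
allVecs-complete {m = suc m} {xs = xs} c (x Vec.∷ v) rewrite allVecs-product xs m =
  ∈-cartesianProductWith⁺ Vec._∷_ (c x) (allVecs-complete c v)

toList-lookup : (v : Vec A n) → toList v ≡ map (lookup v) (allFin n)
toList-lookup v = trans (go v) (sym (map-tabulate id (lookup v)))
  where
  go : ∀ {n} (v : Vec A n) → toList v ≡ List.tabulate (lookup v)
  go Vec.[]       = refl
  go (x Vec.∷ v) = cong (x ∷_) (go v)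

lookup-∈ : (v : Vec A n) (i : Fin n) → lookup v i ∈ toList v
lookup-∈ v i rewrite toList-lookup v = ∈-map⁺ (lookup v) (∈-allFin i)

lookup-ext : {u v : Vec A n} → lookup u ≗ lookup v → u ≡ v
lookup-ext {u = u} {v} h =
  trans (sym (Vec.tabulate∘lookup u)) (trans (Vec.tabulate-cong h) (Vec.tabulate∘lookup v))

count : (A → Bool) → List A → ℕ
count P xs = length (filterᵇ P xs)

count-cong : {P Q : A → Bool} → P ≗ Q → ∀ xs → count P xs ≡ count Q xs
count-cong h [] = refl
count-cong {P = P} {Q} h (x ∷ xs) with P x | Q x | h x
... | true  | .true  | refl = cong suc (count-cong h xs)
... | false | .false | refl = count-cong h xs

count-map : (P : C → Bool) (f : A → C) (xs : List A) → count P (map f xs) ≡ count (P ∘ f) xs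
count-map P f [] = refl
count-map P f (x ∷ xs) with P (f x)
... | true  = cong suc (count-map P f xs)
... | false = count-map P f xs

count-↭ : (P : A → Bool) {xs ys : List A} → xs ↭ ys → count P xs ≡ count P ys
count-↭ P h = ↭-length (filter-↭ (T? ∘ P) h)

count-mono : {P Q : A → Bool} → (∀ x → T (P x) → T (Q x)) → ∀ xs → count P xs ≤ count Q xs
count-mono h [] = z≤n
count-mono {P = P} {Q} h (x ∷ xs) with P x | Q x | h x
... | true  | true  | _ = s≤s (count-mono h xs)
... | true  | false | k = ⊥-elim (k tt)
... | false | true  | _ = ℕ.m≤n⇒m≤1+n (count-mono h xs)
... | false | false | _ = count-mono h xs

count-strict : {P Q : A → Bool} → (∀ x → T (P x) → T (Q x)) →
  ∀ {xs y} → y ∈ xs → T (Q y) → ¬ T (P y) → count P xs < count Q xs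
count-strict {P = P} {Q} h {x ∷ xs} (here refl) q ¬p with P x | Q x
... | true  | _    = ⊥-elim (¬p tt)
... | false | true = s≤s (count-mono h xs)
count-strict {P = P} {Q} h {x ∷ xs} (there y∈) q ¬p with P x | Q x | h x
... | true  | true  | _ = s≤s (count-strict h y∈ q ¬p)
... | true  | false | k = ⊥-elim (k tt)
... | false | true  | _ = ℕ.m≤n⇒m≤1+n (count-strict h y∈ q ¬p)
... | false | false | _ = count-strict h y∈ q ¬p

count-filter : (P Q : A → Bool) (xs : List A) →
  count P (filterᵇ Q xs) ≡ count (λ x → P x ∧ Q x) xs
count-filter P Q [] = refl
count-filter P Q (x ∷ xs) with Q x
... | false rewrite ∧-comm (P x) false = count-filter P Q xs
... | true rewrite ∧-comm (P x) true with P x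
...   | true  = cong suc (count-filter P Q xs)
...   | false = count-filter P Q xs

-- Punching a missed value out of the codomain would inject `Fin (suc n)` into `Fin n`.
injective⇒surjective : {f : Fin n → Fin n} → Injective _≡_ _≡_ f → ∀ y → ∃ λ x → f x ≡ y
injective⇒surjective {n} {f} inj y with any? (λ x → f x ≟ y)
... | yes p = p
injective⇒surjective {suc n} {f} inj y | no ¬p =
  ⊥-elim (<⇒notInjective {f = λ x → punchOut (avoids x)} ℕ.≤-refl
    (λ e → inj (punchOut-injective (avoids _) (avoids _) e)))
  where
  avoids : ∀ x → y ≢ f x
  avoids x e = ¬p (x , sym e)

map-injective-↭ : {f : Fin n → Fin n} → Injective _≡_ _≡_ f → map f (allFin n) ↭ allFin n
map-injective-↭ {n} {f} inj = unique-↭ (Unique.map⁺ inj (Unique.allFin⁺ n)) (Unique.allFin⁺ n)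
  (λ _ → ∈-allFin _)
  (λ {y} _ → let (x , e) = injective⇒surjective inj y in
     subst (_∈ map f (allFin n)) e (∈-map⁺ f (∈-allFin x)))

count-injective : {f : Fin n → Fin n} → Injective _≡_ _≡_ f → ∀ P →
  count (P ∘ f) (allFin n) ≡ count P (allFin n)
count-injective {n} {f} inj P =
  trans (sym (count-map P f (allFin n))) (count-↭ P (map-injective-↭ inj))

count-suc : (P : Fin (suc n) → Bool) →
  count P (allFin (suc n)) ≡ (if P zero then suc (count (P ∘ suc) (allFin n)) else count (P ∘ suc) (allFin n))
count-suc {n} P with P zero
... | true  = cong suc (trans (cong (count P) (sym (map-tabulate id suc))) (count-map P suc (allFin n)))
... | false = trans (cong (count P) (sym (map-tabulate id suc))) (count-map P suc (allFin n))

-- Permutations as injective words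

IsPerm : Word n → Set
IsPerm w = Injective _≡_ _≡_ (lookup w)

distinctᵇ⇒injective : (v : Vec (Fin n) m) → T (distinctᵇ (toList v)) → Injective _≡_ _≡_ (lookup v)
distinctᵇ⇒injective (x Vec.∷ v) t {zero}  {zero}  e = refl
distinctᵇ⇒injective (x Vec.∷ v) t {zero}  {suc j} e =
  ⊥-elim (T-not⁻ (proj₁ (T-∧⁻ t)) (any⁺ (x ==_) (lookup-∈ v j) (≡⇒== e)))
distinctᵇ⇒injective (x Vec.∷ v) t {suc i} {zero}  e =
  ⊥-elim (T-not⁻ (proj₁ (T-∧⁻ t)) (any⁺ (x ==_) (lookup-∈ v i) (≡⇒== (sym e))))
distinctᵇ⇒injective (x Vec.∷ v) t {suc i} {suc j} e =
  cong suc (distinctᵇ⇒injective v (proj₂ (T-∧⁻ {not (any (x ==_) (toList v))} t)) e)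

injective⇒distinctᵇ : (v : Vec (Fin n) m) → Injective _≡_ _≡_ (lookup v) → T (distinctᵇ (toList v))
injective⇒distinctᵇ Vec.[] inj = tt
injective⇒distinctᵇ {m = suc m} (x Vec.∷ v) inj = T-∧⁺
  (T-not⁺ fresh)
  (injective⇒distinctᵇ v (λ e → suc-injective (inj e)))
  where
  fresh : ¬ T (any (x ==_) (toList v))
  fresh t with any⁻ (x ==_) (toList v) t
  ... | y , y∈ , e rewrite toList-lookup v
    with i , _ , refl ← ∈-map⁻ (lookup v) y∈
    with () ← inj {zero} {suc i} (==⇒≡ e)

-- Faces as relations and their lexicographic product

-- A set composition F of [n] is represented by the preorder F x y = (the block of x is weakly
-- left of the block of y), so that ⊙ is the lexicographic product; a permutation w is
-- represented by the linear order ord w in which its word lists [n].  signed false reverses F.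

Rel : ℕ → Set
Rel n = Fin n → Fin n → Bool

infix 4 _≐_
infixr 7 _⊙_

_≐_ : Rel n → Rel n → Set
F ≐ G = ∀ x y → F x y ≡ G x y

_⊙_ : Rel n → Rel n → Rel n
(F ⊙ G) x y = F x y ∧ (not (F y x) ∨ G x y)

oneBlock : Rel n
oneBlock _ _ = true

signed : Bool → Rel n → Rel n
signed true  R x y = R x y
signed false R x y = R y x

≐-sym : {F G : Rel n} → F ≐ G → G ≐ F
≐-sym h x y = sym (h x y)

≐-trans : {F G H : Rel n} → F ≐ G → G ≐ H → F ≐ H
≐-trans h k x y = trans (h x y) (k x y)

⊙-congˡ : {F F′ : Rel n} (G : Rel n) → F ≐ F′ → F ⊙ G ≐ F′ ⊙ G
⊙-congˡ G h x y = cong₂ (λ a b → a ∧ (not b ∨ G x y)) (h x y) (h y x)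

⊙-congʳ : (F : Rel n) {G G′ : Rel n} → G ≐ G′ → F ⊙ G ≐ F ⊙ G′
⊙-congʳ F h x y = cong (λ a → F x y ∧ (not (F y x) ∨ a)) (h x y)

⊙-assoc : (F G H : Rel n) → (F ⊙ G) ⊙ H ≐ F ⊙ (G ⊙ H)
⊙-assoc F G H x y with F x y | F y x | G x y
... | false | _     | _     = refl
... | true  | false | _     = refl
... | true  | true  | false = refl
... | true  | true  | true  = refl

signed-cong : ∀ s {F G : Rel n} → F ≐ G → signed s F ≐ signed s G
signed-cong true  h x y = h x y
signed-cong false h x y = h y x

signed-⊙ : ∀ s (F G : Rel n) → signed s (F ⊙ G) ≐ signed s F ⊙ signed s G
signed-⊙ true  F G x y = refl
signed-⊙ false F G x y = refl

signed-flip : ∀ s (F : Rel n) → signed s (signed false F) ≐ signed (not s) F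
signed-flip true  F x y = refl
signed-flip false F x y = refl

-- Words versus linear orders

byKey : (Fin n → ℕ) → Rel n
byKey k x y = k x ≤ᵇ k y

face : Vec (Fin m) n → Rel n
face g = byKey (toℕ ∘ lookup g)

first : (A → Bool) → List A → A → A
first P []       d = d
first P (x ∷ xs) d = if P x then x else first P xs d

first-spec : (P : A → Bool) {xs : List A} {x d : A} → x ∈ xs → T (P x) → T (P (first P xs d))
first-spec P {y ∷ xs} x∈ t with P y in eq
... | true = subst T (sym eq) tt
first-spec P {y ∷ xs} (here refl) t | false = ⊥-elim (subst T eq t)
first-spec P {y ∷ xs} (there x∈) t  | false = first-spec P x∈ t

pos : Word n → Fin n → Fin n
pos w x = first (λ p → lookup w p == x) (allFin _) x

ord : Word n → Rel n
ord w = byKey (toℕ ∘ pos w)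

pos-lookup : (w : Word n) → IsPerm w → ∀ p → pos w (lookup w p) ≡ p
pos-lookup w inj p = inj (==⇒≡ (first-spec (λ q → lookup w q == lookup w p) (∈-allFin p) (≡⇒== {i = lookup w p} refl)))

ord-lookup : (w : Word n) → IsPerm w → ∀ i j → ord w (lookup w i) (lookup w j) ≡ (toℕ i ≤ᵇ toℕ j)
ord-lookup w inj i j = cong₂ (λ a b → toℕ a ≤ᵇ toℕ b) (pos-lookup w inj i) (pos-lookup w inj j)

-- The inverse of ord: the element with p smaller ones goes to position p.
rank : Rel n → Fin n → ℕ
rank R x = count (λ y → not (R x y)) (allFin _)

decode : Rel n → Word n
decode R = tabulate λ p → first (λ x → rank R x ≡ᵇ toℕ p) (allFin _) p

first-cong : {P Q : A → Bool} → P ≗ Q → ∀ xs d → first P xs d ≡ first Q xs d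
first-cong h []       d = refl
first-cong h (x ∷ xs) d rewrite h x | first-cong h xs d = refl

rank-cong : {R S : Rel n} → R ≐ S → rank R ≗ rank S
rank-cong h x = count-cong (λ y → cong not (h x y)) (allFin _)

decode-cong : {R S : Rel n} → R ≐ S → decode R ≡ decode S
decode-cong h = Vec.tabulate-cong λ p →
  first-cong (λ x → cong (_≡ᵇ toℕ p) (rank-cong h x)) (allFin _) p

rank-decode : (R : Rel n) (p x : Fin n) → rank R x ≡ toℕ p → rank R (lookup (decode R) p) ≡ toℕ p
rank-decode R p x e
  rewrite Vec.lookup∘tabulate (λ p → first (λ x → rank R x ≡ᵇ toℕ p) (allFin _) p) p =
  ℕ.≡ᵇ⇒≡ _ _ (first-spec (λ x → rank R x ≡ᵇ toℕ p) (∈-allFin x) (ℕ.≡⇒≡ᵇ _ _ e))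

count-below : ∀ k n → k ≤ n → count (λ q → not (k ≤ᵇ toℕ q)) (allFin n) ≡ k
count-below zero zero h = refl
count-below zero (suc n) h = trans (count-suc {n} (λ _ → false)) (count-below zero n z≤n)
count-below (suc k) (suc n) (s≤s h) = trans (count-suc {n} (λ q → not (suc k ≤ᵇ toℕ q)))
  (cong suc (trans (count-cong (λ q → cong not (shift k (toℕ q))) (allFin n)) (count-below k n h)))
  where
  shift : ∀ k q → (suc k ≤ᵇ suc q) ≡ (k ≤ᵇ q)
  shift zero    q = refl
  shift (suc k) q = refl

-- Writing each letter as `lookup w q` turns the rank into the number of positions before `p`.
rank-ord : (w : Word n) → IsPerm w → ∀ p → rank (ord w) (lookup w p) ≡ toℕ p
rank-ord {n} w inj p = trans
  (sym (count-injective inj (λ y → not (ord w (lookup w p) y))))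
  (trans (count-cong (λ q → cong not (ord-lookup w inj p q)) (allFin n))
         (count-below (toℕ p) n (ℕ.<⇒≤ (toℕ<n p))))

-- The letter that `decode` puts at position `p` has rank `p`. Written as `lookup w q`, it also has
-- rank `q`, so `q` is `p`.
decode-ord : (w : Word n) → IsPerm w → decode (ord w) ≡ w
decode-ord w inj = lookup-ext λ p →
  let (q , e) = injective⇒surjective inj (lookup (decode (ord w)) p) in
  trans (sym e) (cong (lookup w) (toℕ-injective
    (trans (sym (rank-ord w inj q))
    (trans (cong (rank (ord w)) e) (rank-decode (ord w) p _ (rank-ord w inj p))))))

module _ {k : Fin n → ℕ} (k-inj : Injective _≡_ _≡_ k) where
  private
    R = byKey k

    -- Everything below `x` is below `y`, and `x` itself is counted for `y` but not for `x`.
    rank-mono : ∀ {x y} → k x < k y → rank R x < rank R y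
    rank-mono {x} {y} h = count-strict
      (λ z t → T-not⁺ λ u → T-not⁻ t (ℕ.≤⇒≤ᵇ (ℕ.≤-trans (ℕ.<⇒≤ h) (ℕ.≤ᵇ⇒≤ _ _ u))))
      (∈-allFin x)
      (T-not⁺ λ u → ℕ.<⇒≱ h (ℕ.≤ᵇ⇒≤ _ _ u))
      (λ t → T-not⁻ t (ℕ.≤⇒≤ᵇ (ℕ.≤-refl {k x})))

    rank-injective : ∀ {x y} → rank R x ≡ rank R y → x ≡ y
    rank-injective {x} {y} e with ℕ.<-cmp (k x) (k y)
    ... | tri< h _ _ = ⊥-elim (ℕ.<⇒≢ (rank-mono h) e)
    ... | tri≈ _ h _ = k-inj h
    ... | tri> _ _ h = ⊥-elim (ℕ.<⇒≢ (rank-mono h) (sym e))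

    rank<n : ∀ x → rank R x < n
    rank<n x = ℕ.<-≤-trans
      (count-strict {Q = λ _ → true} (λ _ _ → tt) (∈-allFin x) tt
        (λ t → T-not⁻ t (ℕ.≤⇒≤ᵇ (ℕ.≤-refl {k x}))))
      (ℕ.≤-trans (length-filter _ (allFin n)) (ℕ.≤-reflexive (length-tabulate id)))

    rank-surjective : ∀ p → ∃ λ x → rank R x ≡ toℕ p
    rank-surjective p with x , e ← injective⇒surjective {f = λ x → fromℕ< (rank<n x)}
                                     (λ e → rank-injective (fromℕ<-injective _ _ _ _ e)) p
      = x , trans (sym (toℕ-fromℕ< (rank<n x))) (cong toℕ e)

    rank-lookup : ∀ p → rank R (lookup (decode R) p) ≡ toℕ p
    rank-lookup p = let (x , e) = rank-surjective p in rank-decode R p x e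

  decode-injective : IsPerm (decode R)
  decode-injective {p} {q} e = toℕ-injective
    (trans (sym (rank-lookup p)) (trans (cong (rank R) e) (rank-lookup q)))

  private
    pos-rank : ∀ x → toℕ (pos (decode R) x) ≡ rank R x
    pos-rank x with p , refl ← injective⇒surjective decode-injective x =
      trans (cong toℕ (pos-lookup (decode R) decode-injective p)) (sym (rank-lookup p))

  ord-decode : ord (decode R) ≐ R
  ord-decode x y rewrite pos-rank x | pos-rank y = T-ext
    (λ t → ℕ.≤⇒≤ᵇ (ℕ.≮⇒≥ λ h → ℕ.<⇒≱ (rank-mono h) (ℕ.≤ᵇ⇒≤ _ _ t)))
    (λ t → ℕ.≤⇒≤ᵇ (ℕ.≮⇒≥ λ h → ℕ.<⇒≱ (≤-rank (ℕ.≤ᵇ⇒≤ _ _ t)) h))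
    where
    ≤-rank : k x ≤ k y → rank R x < suc (rank R y)
    ≤-rank h with ℕ.m≤n⇒m<n∨m≡n h
    ... | inj₁ l = ℕ.m<n⇒m<1+n (rank-mono l)
    ... | inj₂ e rewrite k-inj e = ℕ.≤-refl

-- Composition of words and reversal by `w₀`

lookup-∘ₚ : (u w : Word n) → ∀ i → lookup (u ∘ₚ w) i ≡ lookup u (lookup w i)
lookup-∘ₚ u w i = Vec.lookup-map i (lookup u) w

∘ₚ-assoc : (u v w : Word n) → u ∘ₚ (v ∘ₚ w) ≡ (u ∘ₚ v) ∘ₚ w
∘ₚ-assoc u v w = lookup-ext λ i → trans (lookup-∘ₚ u (v ∘ₚ w) i) (trans (cong (lookup u) (lookup-∘ₚ v w i))
  (sym (trans (lookup-∘ₚ (u ∘ₚ v) w i) (lookup-∘ₚ u v (lookup w i)))))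

∘ₚ-identityʳ : (u : Word n) → u ∘ₚ idPerm n ≡ u
∘ₚ-identityʳ = Vec.map-lookup-allFin

∘ₚ-identityˡ : (u : Word n) → idPerm n ∘ₚ u ≡ u
∘ₚ-identityˡ u = lookup-ext λ i → trans (lookup-∘ₚ (idPerm _) u i) (Vec.lookup∘tabulate id (lookup u i))

∘ₚ-injective : (u w : Word n) → IsPerm u → IsPerm w → IsPerm (u ∘ₚ w)
∘ₚ-injective u w p q {i} {j} e = q (p (trans (sym (lookup-∘ₚ u w i)) (trans e (lookup-∘ₚ u w j))))

idPerm-injective : IsPerm (idPerm n)
idPerm-injective {n} {i} {j} e = trans (sym (Vec.lookup∘tabulate id i)) (trans e (Vec.lookup∘tabulate id j))

w₀-injective : IsPerm (w₀ n)
w₀-injective {n} {i} {j} e = trans (sym (opposite-involutive i)) (trans (cong opposite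
  (trans (sym (Vec.lookup∘tabulate opposite i)) (trans e (Vec.lookup∘tabulate opposite j)))) (opposite-involutive j))

-- The word of `u ∘ₚ w₀ n` is the word of `u` read backwards, so position `i` corresponds to
-- position `n ∸ suc i` of `u`.
ord-∘w₀ : (u : Word n) → IsPerm u → ord (u ∘ₚ w₀ n) ≐ signed false (ord u)
ord-∘w₀ {n} u inj x y
  with i , refl ← injective⇒surjective (∘ₚ-injective u (w₀ n) inj w₀-injective) x
     | j , refl ← injective⇒surjective (∘ₚ-injective u (w₀ n) inj w₀-injective) y =
  trans (ord-lookup (u ∘ₚ w₀ n) (∘ₚ-injective u (w₀ n) inj w₀-injective) i j)
  (trans reverse (sym (cong₂ _≤ᵇ_ (pos-opp j) (pos-opp i))))
  where
  pos-opp : ∀ i → toℕ (pos u (lookup (u ∘ₚ w₀ n) i)) ≡ n ℕ.∸ suc (toℕ i)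
  pos-opp i = trans (cong (toℕ ∘ pos u) (trans (lookup-∘ₚ u (w₀ n) i) (cong (lookup u) (Vec.lookup∘tabulate opposite i))))
    (trans (cong toℕ (pos-lookup u inj (opposite i))) (opposite-prop i))
  reverse : (toℕ i ≤ᵇ toℕ j) ≡ (n ℕ.∸ suc (toℕ j) ≤ᵇ n ℕ.∸ suc (toℕ i))
  reverse = T-ext
    (λ t → ℕ.≤⇒≤ᵇ (ℕ.∸-monoʳ-≤ n (s≤s (ℕ.≤ᵇ⇒≤ _ _ t))))
    (λ t → ℕ.≤⇒≤ᵇ (ℕ.≮⇒≥ λ h → ℕ.<⇒≱ (ℕ.∸-monoʳ-< (s≤s h) (toℕ<n i)) (ℕ.≤ᵇ⇒≤ _ _ t)))

-- Consecutive blocks of positions and descent sets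

-- The standard set composition of type `α`, whose blocks are runs of consecutive positions.
blk : (α : List ℕ) → Fin (sum α) → Fin (length α)
blk (a ∷ α) p = [ (λ _ → zero) , suc ∘ blk α ]′ (splitAt a p)

-- Trades matching on `splitAt` for facts about `toℕ p`, the form in which the order arguments below
-- consume it.
blk-view : ∀ a α (p : Fin (sum (a ∷ α))) →
  (toℕ p < a × blk (a ∷ α) p ≡ zero) ⊎
  (∃ λ j → toℕ p ≡ a ℕ.+ toℕ j × blk (a ∷ α) p ≡ suc (blk α j))
blk-view a α p with splitAt a p in eq
... | inj₁ i = inj₁ (subst (_< a) (trans (sym (toℕ-↑ˡ i (sum α))) (cong toℕ (splitAt⁻¹-↑ˡ eq))) (toℕ<n i) , refl)
... | inj₂ j = inj₂ (j , trans (cong toℕ (sym (splitAt⁻¹-↑ʳ {a} eq))) (toℕ-↑ʳ a j) , refl)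

private
  ≥-absurd : ∀ {a j p} → p < a → p ≡ a ℕ.+ j → ∀ {ℓ} {X : Set ℓ} → X
  ≥-absurd {a} {j} h refl = ⊥-elim (ℕ.<⇒≱ h (ℕ.m≤m+n a j))

blk-mono : ∀ α p q → toℕ p ≤ toℕ q → toℕ (blk α p) ≤ toℕ (blk α q)
blk-mono (a ∷ α) p q h with blk-view a α p | blk-view a α q
... | inj₁ (_ , e) | _ rewrite e = z≤n
... | inj₂ (j , e , _) | inj₁ (l , _) = ≥-absurd (ℕ.≤-<-trans h l) e
... | inj₂ (j , e , f) | inj₂ (k , e′ , f′) rewrite f | f′ =
  s≤s (blk-mono α j k (ℕ.+-cancelˡ-≤ a _ _ (subst₂ _≤_ e e′ h)))

-- Positions are 0-based and descents 1-based, so the step from `p` to `q = p + 1` carries the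
-- number `toℕ q`. The total of the parts already stripped off is `acc`.
blk-cut⁺ : ∀ acc α p q → toℕ q ≡ suc (toℕ p) → blk α p ≢ blk α q → acc ℕ.+ toℕ q ∈ partialSums acc α
blk-cut⁺ acc (a ∷ α) p q s d with blk-view a α p | blk-view a α q
... | inj₁ (_ , e) | inj₁ (_ , f) = ⊥-elim (d (trans e (sym f)))
... | inj₂ (j , e , _) | inj₁ (l , _) = ≥-absurd (ℕ.<⇒≤ (subst (_< a) s l)) e
blk-cut⁺ acc (a ∷ b ∷ r) p q s d | inj₁ (l , _) | inj₂ (k , e , _) =
  here (cong (acc ℕ.+_) (ℕ.≤-antisym (subst (_≤ a) (sym s) l) (subst (a ≤_) (sym e) (ℕ.m≤m+n a _))))
blk-cut⁺ acc (a ∷ b ∷ r) p q s d | inj₂ (j , e , f) | inj₂ (k , e′ , f′) =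
  there (subst (_∈ partialSums (acc ℕ.+ a) (b ∷ r)) (trans (ℕ.+-assoc acc a _) (cong (acc ℕ.+_) (sym e′)))
    (blk-cut⁺ (acc ℕ.+ a) (b ∷ r) j k
      (ℕ.+-cancelˡ-≡ a _ _ (trans (sym e′) (trans s (trans (cong suc e) (sym (ℕ.+-suc a _))))))
      (λ g → d (trans f (trans (cong suc g) (sym f′))))))

partialSums-≥ : ∀ acc α {x} → x ∈ partialSums acc α → acc ≤ x
partialSums-≥ acc (a ∷ b ∷ r) (here refl) = ℕ.m≤m+n acc a
partialSums-≥ acc (a ∷ b ∷ r) (there h) = ℕ.≤-trans (ℕ.m≤m+n acc a) (partialSums-≥ (acc ℕ.+ a) (b ∷ r) h)

partialSums-∷⁻ : ∀ acc a α {x} → x ∈ partialSums acc (a ∷ α) →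
  x ≡ acc ℕ.+ a ⊎ x ∈ partialSums (acc ℕ.+ a) α
partialSums-∷⁻ acc a (b ∷ r) (here e)  = inj₁ e
partialSums-∷⁻ acc a (b ∷ r) (there h) = inj₂ h

blk-cut⁻ : ∀ acc α p q → toℕ q ≡ suc (toℕ p) → acc ℕ.+ toℕ q ∈ partialSums acc α → blk α p ≢ blk α q
blk-cut⁻ acc (a ∷ α) p q s h e
  with blk-view a α p | blk-view a α q | partialSums-∷⁻ acc a α h
... | inj₁ (_ , f) | inj₂ (_ , _ , g) | _ with () ← trans (sym f) (trans e g)
... | inj₂ (_ , _ , f) | inj₁ (_ , g) | _ with () ← trans (sym f) (trans e g)
... | inj₁ _ | inj₁ (l , _) | inj₁ g = ℕ.<⇒≢ l (ℕ.+-cancelˡ-≡ acc _ _ g)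
... | inj₁ _ | inj₁ (l , _) | inj₂ h′ =
  ℕ.<⇒≱ l (ℕ.+-cancelˡ-≤ acc _ _ (partialSums-≥ (acc ℕ.+ a) α h′))
-- A cut right after the first part makes `q` the first position of the rest, so `p` would still lie
-- in the first part.
... | inj₂ (j , f , _) | inj₂ _ | inj₁ g =
  ≥-absurd (ℕ.≤-reflexive (trans (sym s) (ℕ.+-cancelˡ-≡ acc _ _ g))) f
... | inj₂ (j , f , f′) | inj₂ (k , g , g′) | inj₂ h′ =
  blk-cut⁻ (acc ℕ.+ a) α j k
    (ℕ.+-cancelˡ-≡ a _ _ (trans (sym g) (trans s (trans (cong suc f) (sym (ℕ.+-suc a _))))))
    (subst (_∈ partialSums (acc ℕ.+ a) α) (trans (cong (acc ℕ.+_) g) (sym (ℕ.+-assoc acc a _))) h′)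
    (suc-injective (trans (sym f′) (trans e g′)))

∈ᵇ⇒∈ : ∀ {x S} → T (x ∈ᵇ S) → x ∈ S
∈ᵇ⇒∈ {x} {S} t with y , y∈ , e ← any⁻ (x ≡ᵇ_) S t rewrite ℕ.≡ᵇ⇒≡ x y e = y∈

∈⇒∈ᵇ : ∀ {x S} → x ∈ S → T (x ∈ᵇ S)
∈⇒∈ᵇ {x} h = any⁺ (x ≡ᵇ_) h (ℕ.≡⇒≡ᵇ x x refl)

descents⁻ : ∀ {S} i (xs : Vec ℕ m) → T (all (_∈ᵇ S) (descents i (toList xs))) →
  ∀ p q → toℕ q ≡ suc (toℕ p) → lookup xs q < lookup xs p → i ℕ.+ toℕ p ∈ S
descents⁻ i (a Vec.∷ Vec.[]) t zero zero () l
descents⁻ i (a Vec.∷ b Vec.∷ r) t zero (suc zero) e l with b <ᵇ a in eq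
... | true rewrite ℕ.+-identityʳ i = ∈ᵇ⇒∈ (proj₁ (T-∧⁻ t))
... | false = ⊥-elim (subst T eq (ℕ.<⇒<ᵇ l))
descents⁻ {S = S} i (a Vec.∷ b Vec.∷ r) t (suc p) (suc q) e l with b <ᵇ a
... | true rewrite ℕ.+-suc i (toℕ p) = descents⁻ (suc i) (b Vec.∷ r) (proj₂ (T-∧⁻ {i ∈ᵇ S} t)) p q (ℕ.suc-injective e) l
... | false rewrite ℕ.+-suc i (toℕ p) = descents⁻ (suc i) (b Vec.∷ r) t p q (ℕ.suc-injective e) l

descents-∷⁺ : ∀ {S} i a b xs → (b < a → i ∈ S) → T (all (_∈ᵇ S) (descents (suc i) (b ∷ xs))) →
  T (all (_∈ᵇ S) (descents i (a ∷ b ∷ xs)))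
descents-∷⁺ i a b xs h t with b <ᵇ a in eq
... | true  = T-∧⁺ (∈⇒∈ᵇ (h (ℕ.<ᵇ⇒< b a (subst T (sym eq) tt)))) t
... | false = t

descents⁺ : ∀ {S} i (xs : Vec ℕ m) →
  (∀ p q → toℕ q ≡ suc (toℕ p) → lookup xs q < lookup xs p → i ℕ.+ toℕ p ∈ S) →
  T (all (_∈ᵇ S) (descents i (toList xs)))
descents⁺ i Vec.[] h = tt
descents⁺ i (a Vec.∷ Vec.[]) h = tt
descents⁺ {S = S} i (a Vec.∷ b Vec.∷ r) h = descents-∷⁺ i a b (toList r)
  (λ l → subst (_∈ S) (ℕ.+-identityʳ i) (h zero (suc zero) refl l))
  (descents⁺ (suc i) (b Vec.∷ r) λ p q e l → subst (_∈ S) (ℕ.+-suc i (toℕ p)) (h (suc p) (suc q) (cong suc e) l))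

module _ (α : List ℕ) (w : Word (sum α)) where
  DesSubset⁺ : (∀ p q → toℕ q ≡ suc (toℕ p) → toℕ (lookup w q) < toℕ (lookup w p) → blk α p ≢ blk α q) →
               T (DesSubset α w)
  DesSubset⁺ h = descents⁺ 1 (Vec.map toℕ w) λ p q e l → subst (_∈ D α) e
    (blk-cut⁺ 0 α p q e (h p q e (subst₂ _<_ (Vec.lookup-map q toℕ w) (Vec.lookup-map p toℕ w) l)))

  -- Induction on the distance from `p` to `q`: by `blk-mono` every position in between lies in the
  -- same block, so no step on the way is a descent.
  increasing-in-blocks : T (DesSubset α w) → ∀ p q → toℕ p ≤ toℕ q → blk α p ≡ blk α q →
                         toℕ (lookup w p) ≤ toℕ (lookup w q)
  increasing-in-blocks t p q h = go (toℕ q ℕ.∸ toℕ p) q (sym (ℕ.m∸n+n≡m h))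
    where
    step : ∀ p q → toℕ q ≡ suc (toℕ p) → blk α p ≡ blk α q → toℕ (lookup w p) ≤ toℕ (lookup w q)
    step p q e b = ℕ.≮⇒≥ λ l → blk-cut⁻ 0 α p q e
      (subst (_∈ D α) (sym e) (descents⁻ 1 (Vec.map toℕ w) t p q e
        (subst₂ _<_ (sym (Vec.lookup-map q toℕ w)) (sym (Vec.lookup-map p toℕ w)) l))) b
    go : ∀ d q → toℕ q ≡ d ℕ.+ toℕ p → blk α p ≡ blk α q → toℕ (lookup w p) ≤ toℕ (lookup w q)
    go zero    q e b rewrite toℕ-injective e = ℕ.≤-refl
    go (suc d) q e b = ℕ.≤-trans (go d q′ e′ b₁) (step q′ q (trans e (cong suc (sym e′))) (trans (sym b₁) b))
      where
      d<n : d ℕ.+ toℕ p < sum α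
      d<n = ℕ.<-trans (ℕ.≤-reflexive (sym e)) (toℕ<n q)
      q′ = fromℕ< d<n
      e′ : toℕ q′ ≡ d ℕ.+ toℕ p
      e′ = toℕ-fromℕ< d<n
      b₁ : blk α p ≡ blk α q′
      b₁ = toℕ-injective (ℕ.≤-antisym
        (blk-mono α p q′ (subst (toℕ p ≤_) (sym e′) (ℕ.m≤n+m _ d)))
        (subst (λ z → toℕ (blk α q′) ≤ toℕ z) (sym b)
          (blk-mono α q′ q (ℕ.≤-trans (ℕ.≤-reflexive e′) (ℕ.≤-trans (ℕ.n≤1+n _) (ℕ.≤-reflexive (sym e)))))))

-- Types of set compositions

listEqᵇ⇒≡ : ∀ xs ys → T (listEqᵇ xs ys) → xs ≡ ys
listEqᵇ⇒≡ []       []       t = refl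
listEqᵇ⇒≡ (x ∷ xs) (y ∷ ys) t =
  cong₂ _∷_ (ℕ.≡ᵇ⇒≡ x y (proj₁ (T-∧⁻ t))) (listEqᵇ⇒≡ xs ys (proj₂ (T-∧⁻ {x ≡ᵇ y} t)))

≡⇒listEqᵇ : ∀ xs → T (listEqᵇ xs xs)
≡⇒listEqᵇ []       = tt
≡⇒listEqᵇ (x ∷ xs) = T-∧⁺ (ℕ.≡⇒≡ᵇ x x refl) (≡⇒listEqᵇ xs)

count-toList : (P : A → Bool) (g : Vec A n) → count P (toList g) ≡ count (P ∘ lookup g) (allFin n)
count-toList P g = trans (cong (count P) (toList-lookup g)) (count-map P (lookup g) (allFin _))

typeOf-relabel : (g : Vec (Fin m) n) {f : Fin n → Fin n} → Injective _≡_ _≡_ f →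
  typeOf (tabulate (lookup g ∘ f)) ≡ typeOf g
typeOf-relabel g {f} inj = map-cong (λ j →
  trans (count-toList (j ==_) (tabulate (lookup g ∘ f)))
  (trans (count-cong (λ i → cong (j ==_) (Vec.lookup∘tabulate (lookup g ∘ f) i)) (allFin _))
  (trans (count-injective inj (λ i → j == lookup g i)) (sym (count-toList (j ==_) g))))) (allFin _)

count-true : (xs : List A) → count (λ _ → true) xs ≡ length xs
count-true []       = refl
count-true (x ∷ xs) = cong suc (count-true xs)

count-false : (xs : List A) → count (λ _ → false) xs ≡ 0
count-false []       = refl
count-false (x ∷ xs) = count-false xs

count-+ : ∀ a b (P : Fin (a ℕ.+ b) → Bool) →
  count P (allFin (a ℕ.+ b)) ≡ count (P ∘ (_↑ˡ b)) (allFin a) ℕ.+ count (P ∘ (a ↑ʳ_)) (allFin b)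
count-+ zero    b P = refl
count-+ (suc a) b P
  rewrite count-suc {a ℕ.+ b} P | count-suc {a} (P ∘ (_↑ˡ b)) with P zero
... | true  = cong suc (count-+ a b (P ∘ suc))
... | false = count-+ a b (P ∘ suc)

count-blk : ∀ α j → count (λ p → j == blk α p) (allFin (sum α)) ≡ List.lookup α j
count-blk (a ∷ α) zero = trans (count-+ a (sum α) _) (trans (cong₂ ℕ._+_
  (trans (count-cong (λ i → cong (λ s → zero == [ (λ _ → zero) , suc ∘ blk α ]′ s) (splitAt-↑ˡ a i (sum α))) (allFin a))
         (trans (count-true (allFin a)) (length-tabulate id)))
  (trans (count-cong (λ i → cong (λ s → zero == [ (λ _ → zero) , suc ∘ blk α ]′ s) (splitAt-↑ʳ a (sum α) i)) (allFin (sum α)))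
         (count-false (allFin (sum α)))))
  (ℕ.+-identityʳ a))
count-blk (a ∷ α) (suc j) = trans (count-+ a (sum α) _) (cong₂ ℕ._+_
  (trans (count-cong (λ i → cong (λ s → suc j == [ (λ _ → zero) , suc ∘ blk α ]′ s) (splitAt-↑ˡ a i (sum α))) (allFin a))
         (count-false (allFin a)))
  (trans (count-cong (λ i → cong (λ s → suc j == [ (λ _ → zero) , suc ∘ blk α ]′ s) (splitAt-↑ʳ a (sum α) i)) (allFin (sum α)))
         (count-blk α j)))

typeOf-blk : ∀ α → typeOf (tabulate (blk α)) ≡ α
typeOf-blk α = trans (map-cong (λ j →
  trans (count-toList (j ==_) (tabulate (blk α)))
  (trans (count-cong (λ i → cong (j ==_) (Vec.lookup∘tabulate (blk α) i)) (allFin _))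
         (count-blk α j))) (allFin _))
  (trans (map-tabulate id (List.lookup α)) (tabulate-lookup α))

map-≡⁻ : {f g : A → C} (xs : List A) → map f xs ≡ map g xs → ∀ {x} → x ∈ xs → f x ≡ g x
map-≡⁻ (x ∷ xs) e (here refl) = proj₁ (∷-injective e)
map-≡⁻ (x ∷ xs) e (there h)   = map-≡⁻ xs (proj₂ (∷-injective e)) h

Monotone : Vec (Fin m) n → Set
Monotone g = ∀ i j → toℕ i ≤ toℕ j → toℕ (lookup g i) ≤ toℕ (lookup g j)

-- The head of a weakly increasing word is its least letter. A head smaller than the other head
-- would be absent from the other word, against the equal multiplicities; so the heads agree and
-- cancel.
monotone-unique : (g h : Vec (Fin m) n) → Monotone g → Monotone h →
  (∀ j → count (j ==_) (toList g) ≡ count (j ==_) (toList h)) → g ≡ h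
monotone-unique Vec.[] Vec.[] mg mh e = refl
monotone-unique {m} (x Vec.∷ g) (y Vec.∷ h) mg mh e =
  cong₂ Vec._∷_ x≡y (monotone-unique g h
    (λ i j l → mg (suc i) (suc j) (s≤s l)) (λ i j l → mh (suc i) (suc j) (s≤s l)) tails)
  where
  absent : ∀ {k x} (v : Vec (Fin m) k) → (∀ i → x ≢ lookup v i) → count (x ==_) (toList v) ≡ 0
  absent {k} {x} v h = trans (count-toList (x ==_) v)
    (trans (count-cong (λ i → T-ext {x == lookup v i} {false} (λ t → h i (==⇒≡ t)) λ ()) (allFin k))
           (count-false (allFin k)))
  present : ∀ {k} x (v : Vec (Fin m) k) → count (x ==_) (x ∷ toList v) ≢ 0
  present x v with x ≟ x
  ... | yes _ = λ ()
  ... | no ¬p = ⊥-elim (¬p refl)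
  head-≮ : ∀ {k} x y (g h : Vec (Fin m) k) → Monotone (y Vec.∷ h) →
    count (x ==_) (x ∷ toList g) ≡ count (x ==_) (y ∷ toList h) → ¬ toℕ x < toℕ y
  head-≮ x y g h mh e l = present x g (trans e (absent (y Vec.∷ h) λ i eq →
    ℕ.<⇒≱ l (subst (λ z → toℕ y ≤ toℕ z) (sym eq) (mh zero i z≤n))))
  x≡y : x ≡ y
  x≡y = toℕ-injective (ℕ.≤-antisym (ℕ.≮⇒≥ (head-≮ y x h g mg (sym (e y)))) (ℕ.≮⇒≥ (head-≮ x y g h mh (e x))))
  tails : ∀ j → count (j ==_) (toList g) ≡ count (j ==_) (toList h)
  tails j with e j
  ... | ej rewrite x≡y with j ≟ y
  ...   | yes _ = ℕ.suc-injective ej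
  ...   | no _  = ej

-- Injectivity is asked on the members of the list, because `blocks` separates the elements of
-- `desPerms` but need not separate arbitrary words.
unique-map : {f : A → C} {xs : List A} → (∀ {x y} → x ∈ xs → y ∈ xs → f x ≡ f y → x ≡ y) →
  Unique xs → Unique (map f xs)
unique-map inj AllPairs.[] = AllPairs.[]
unique-map inj (a AllPairs.∷ u) =
  All.map⁺ (All.tabulate (λ y∈ e → All.lookup a y∈ (inj (here refl) (there y∈) e)))
  AllPairs.∷ unique-map (λ p q → inj (there p) (there q)) u

-- The bijection between the terms of `B α` and the faces of type `α`

facesOfType : ∀ n (α : List ℕ) → List (Vec (Fin (length α)) n)
facesOfType n α = filterᵇ (λ g → listEqᵇ (typeOf g) α) (allVecs (allFin (length α)) n)

desPerms : ∀ n → List ℕ → List (Word n)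
desPerms n α = filterᵇ (DesSubset α) (allPerms n)

module _ (α : List ℕ) where
  private
    N = sum α

  ∈-desPerms⁺ : (w : Word N) → IsPerm w → T (DesSubset α w) → w ∈ desPerms N α
  ∈-desPerms⁺ w inj t = ∈-filter⁺ _ (∈-filter⁺ _ (allVecs-complete ∈-allFin w) (injective⇒distinctᵇ w inj)) t

  ∈-desPerms⁻ : ∀ {w} → w ∈ desPerms N α → IsPerm w × T (DesSubset α w)
  ∈-desPerms⁻ {w} h =
    let (h′ , t) = ∈-filter⁻ _ {xs = allPerms N} h
        (_ , d)  = ∈-filter⁻ _ {xs = allVecs (allFin N) N} h′
    in distinctᵇ⇒injective w d , t

  module _ (u : Word N) (u-inj : IsPerm u) where

    -- The face `G` for which the chamber of `u ∘ₚ w` is `G` times the chamber of `u`, when `w`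
    -- occurs in `B α`.
    blocks : Word N → Vec (Fin (length α)) N
    blocks w = tabulate (blk α ∘ pos (u ∘ₚ w))

    module _ (w : Word N) (w-inj : IsPerm w) where
      private
        uw-inj : IsPerm (u ∘ₚ w)
        uw-inj = ∘ₚ-injective u w u-inj w-inj

      blocks-lookup : ∀ p → lookup (blocks w) (lookup (u ∘ₚ w) p) ≡ blk α p
      blocks-lookup p = trans (Vec.lookup∘tabulate _ (lookup (u ∘ₚ w) p))
        (cong (blk α) (pos-lookup (u ∘ₚ w) uw-inj p))

      typeOf-blocks : typeOf (blocks w) ≡ α
      typeOf-blocks = trans (sym (typeOf-relabel (blocks w) uw-inj))
        (trans (cong typeOf (Vec.tabulate-cong blocks-lookup)) (typeOf-blk α))

      ord-u-lookup : ∀ p q → ord u (lookup (u ∘ₚ w) p) (lookup (u ∘ₚ w) q)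
                           ≡ (toℕ (lookup w p) ≤ᵇ toℕ (lookup w q))
      ord-u-lookup p q rewrite lookup-∘ₚ u w p | lookup-∘ₚ u w q = ord-lookup u u-inj (lookup w p) (lookup w q)

      -- Inside a run of `α` the word `w` increases, so `u ∘ₚ w` lists the letters of that run in
      -- the order in which `u` does.
      ord-blocks : T (DesSubset α w) → ord (u ∘ₚ w) ≐ face (blocks w) ⊙ ord u
      ord-blocks t x y
        with p , refl ← injective⇒surjective uw-inj x
           | q , refl ← injective⇒surjective uw-inj y
        rewrite ord-lookup (u ∘ₚ w) uw-inj p q | ord-u-lookup p q
              | blocks-lookup p | blocks-lookup q = T-ext (λ h → lex p q (ℕ.≤ᵇ⇒≤ _ _ h)) back
        where
        Lex : Fin N → Fin N → Bool
        Lex p q = (toℕ (blk α p) ≤ᵇ toℕ (blk α q)) ∧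
                  (not (toℕ (blk α q) ≤ᵇ toℕ (blk α p)) ∨ (toℕ (lookup w p) ≤ᵇ toℕ (lookup w q)))
        lex : ∀ p q → toℕ p ≤ toℕ q → T (Lex p q)
        lex p q h = T-∧⁺ (ℕ.≤⇒≤ᵇ (blk-mono α p q h)) (second (toℕ (blk α q) ≤ᵇ toℕ (blk α p)) refl)
          where
          second : ∀ b → (toℕ (blk α q) ≤ᵇ toℕ (blk α p)) ≡ b → T (not b ∨ (toℕ (lookup w p) ≤ᵇ toℕ (lookup w q)))
          second false e = tt
          second true  e = ℕ.≤⇒≤ᵇ (increasing-in-blocks α w t p q h
            (toℕ-injective (ℕ.≤-antisym (blk-mono α p q h) (ℕ.≤ᵇ⇒≤ _ _ (subst T (sym e) tt)))))
        lex-antisym : ∀ p q → T (Lex p q) → T (Lex q p) → p ≡ q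
        lex-antisym p q s t with T-∧⁻ {toℕ (blk α p) ≤ᵇ toℕ (blk α q)} s | T-∧⁻ {toℕ (blk α q) ≤ᵇ toℕ (blk α p)} t
        ... | s₁ , s₂ | t₁ , t₂
          with toℕ (blk α p) ≤ᵇ toℕ (blk α q) | toℕ (blk α q) ≤ᵇ toℕ (blk α p)
        ... | true | true = w-inj (toℕ-injective (ℕ.≤-antisym (ℕ.≤ᵇ⇒≤ _ _ s₂) (ℕ.≤ᵇ⇒≤ _ _ t₂)))
        -- Positions are totally ordered and `Lex` is antisymmetric, so the converse follows from
        -- the forward implication `lex`.
        back : T (Lex p q) → T (toℕ p ≤ᵇ toℕ q)
        back s = ℕ.≤⇒≤ᵇ (ℕ.≮⇒≥ λ l → ℕ.<⇒≢ l (cong toℕ (sym (lex-antisym p q s (lex q p (ℕ.<⇒≤ l))))))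

    -- By `ord-blocks` the face and `u` determine `ord (u ∘ₚ w)`; `decode` then gives back `u ∘ₚ w`,
    -- and `u` cancels.
    blocks-injective : ∀ {w w′} → w ∈ desPerms N α → w′ ∈ desPerms N α → blocks w ≡ blocks w′ → w ≡ w′
    blocks-injective {w} {w′} h h′ e =
      let (i , t)   = ∈-desPerms⁻ h
          (i′ , t′) = ∈-desPerms⁻ h′
          uw≡uw′ : u ∘ₚ w ≡ u ∘ₚ w′
          uw≡uw′ = trans (sym (decode-ord (u ∘ₚ w) (∘ₚ-injective u w u-inj i)))
            (trans (decode-cong (≐-trans (ord-blocks w i t)
                     (≐-trans (λ x y → cong (λ g → (face g ⊙ ord u) x y) e) (≐-sym (ord-blocks w′ i′ t′)))))
                   (decode-ord (u ∘ₚ w′) (∘ₚ-injective u w′ u-inj i′)))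
      in lookup-ext λ p → u-inj (trans (sym (lookup-∘ₚ u w p)) (trans (cong (λ v → lookup v p) uw≡uw′) (lookup-∘ₚ u w′ p)))

    -- The preimage of g lists the positions of u by block of g, increasingly within blocks.
    module _ (g : Vec (Fin (length α)) N) (type-g : typeOf g ≡ α) where
      private
        block : Fin N → Fin (length α)
        block = lookup g ∘ lookup u

        -- The value of `combine b i` is `N * b + i` with `i < N`, so comparing keys is comparing
        -- blocks first and positions second.
        key : Fin N → ℕ
        key i = toℕ (combine (block i) i)

        key-injective : Injective _≡_ _≡_ key
        key-injective {i} {j} e = proj₂ (combine-injective (block i) i (block j) j (toℕ-injective e))

      sorting : Word N
      sorting = decode (byKey key)

      sorting-injective : IsPerm sorting
      sorting-injective = decode-injective key-injective

      private
        key-sorted : ∀ p q → toℕ p ≤ toℕ q → key (lookup sorting p) ≤ key (lookup sorting q)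
        key-sorted p q h = ℕ.≤ᵇ⇒≤ _ _ (subst T
          (trans (sym (ord-lookup sorting sorting-injective p q)) (ord-decode key-injective _ _)) (ℕ.≤⇒≤ᵇ h))

        block-sorted : Monotone (tabulate (block ∘ lookup sorting))
        block-sorted p q h
          rewrite Vec.lookup∘tabulate (block ∘ lookup sorting) p | Vec.lookup∘tabulate (block ∘ lookup sorting) q =
          ℕ.≮⇒≥ λ l → ℕ.<⇒≱ (combine-monoˡ-< (lookup sorting q) (lookup sorting p) l) (key-sorted p q h)

        blk-monotone : Monotone (tabulate (blk α))
        blk-monotone p q h rewrite Vec.lookup∘tabulate (blk α) p | Vec.lookup∘tabulate (blk α) q = blk-mono α p q h

        -- Both sides are weakly increasing words of type `α`, so `monotone-unique` applies.
        block-blk : ∀ p → block (lookup sorting p) ≡ blk α p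
        block-blk p = trans (sym (Vec.lookup∘tabulate (block ∘ lookup sorting) p)) (trans (cong (λ v → lookup v p)
          (monotone-unique (tabulate (block ∘ lookup sorting)) (tabulate (blk α)) block-sorted blk-monotone λ j → map-≡⁻ (allFin _)
            (trans (trans (typeOf-relabel g (λ e → sorting-injective (u-inj e))) type-g) (sym (typeOf-blk α)))
            (∈-allFin j)))
          (Vec.lookup∘tabulate (blk α) p))

      sorting-∈ : sorting ∈ desPerms N α
      sorting-∈ = ∈-desPerms⁺ sorting sorting-injective (DesSubset⁺ α sorting λ p q e l b →
        -- For neighbours in one block the multiples of `N` in their keys agree and cancel, leaving
        -- the comparison of the letters of `sorting`.
        ℕ.<⇒≱ l (ℕ.+-cancelˡ-≤ (N ℕ.* toℕ (block (lookup sorting p))) _ _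
          (subst₂ _≤_ (toℕ-combine (block (lookup sorting p)) (lookup sorting p))
            (trans (toℕ-combine (block (lookup sorting q)) (lookup sorting q))
              (cong (λ z → N ℕ.* toℕ z ℕ.+ toℕ (lookup sorting q))
                (trans (block-blk q) (trans (sym b) (sym (block-blk p))))))
            (key-sorted p q (ℕ.≤-trans (ℕ.n≤1+n _) (ℕ.≤-reflexive (sym e)))))))

      blocks-sorting : blocks sorting ≡ g
      blocks-sorting = lookup-ext λ x →
        let (p , e) = injective⇒surjective (∘ₚ-injective u sorting u-inj sorting-injective) x in
        trans (cong (lookup (blocks sorting)) (sym e)) (trans (blocks-lookup sorting sorting-injective p)
        (trans (sym (block-blk p)) (cong (lookup g) (trans (sym (lookup-∘ₚ u sorting p)) e))))

    -- Used in `hat-chamber` to turn the sum over the terms of `B α` into the sum over all faces of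
    -- type `α`, for each fixed chamber `u`.
    blocks-↭ : map blocks (desPerms N α) ↭ facesOfType N α
    blocks-↭ = unique-↭
      (unique-map blocks-injective
        (Unique.filter⁺ _ (Unique.filter⁺ _ (allVecs-unique (Unique.allFin⁺ N) N))))
      (Unique.filter⁺ _ (allVecs-unique (Unique.allFin⁺ (length α)) N))
      (λ h → let (w , w∈ , e) = ∈-map⁻ blocks h in
        subst (_∈ facesOfType N α) (sym e) (∈-filter⁺ _ (allVecs-complete ∈-allFin (blocks w))
          (subst (λ β → T (listEqᵇ β α)) (sym (typeOf-blocks w (proj₁ (∈-desPerms⁻ w∈)))) (≡⇒listEqᵇ α))))
      (λ {g} h → let type-g = listEqᵇ⇒≡ _ _ (proj₂ (∈-filter⁻ _ {xs = allVecs (allFin (length α)) N} h)) in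
        subst (_∈ map blocks (desPerms N α)) (blocks-sorting g type-g) (∈-map⁺ blocks (sorting-∈ g type-g)))

-- Refinement and the number of coarsenings

sameBlock : Rel n → Fin n → Fin n → Bool
sameBlock F x y = F x y ∧ F y x

sameBlock-sym : (F : Rel n) → ∀ x y → T (sameBlock F x y) → T (sameBlock F y x)
sameBlock-sym F x y t = let (p , q) = T-∧⁻ {F x y} t in T-∧⁺ q p

-- Shaped like `refinesᵇ`, with a relation in place of the finer word, so that `coarsenings-∈` can
-- match the two counts term by term.
refines : Rel n → Vec (Fin m) n → Bool
refines F g =
  all (λ x → all (λ y → not (sameBlock F x y) ∨ (lookup g x == lookup g y)) (allFin _)) (allFin _)

refines⁻ : (F : Rel n) (g : Vec (Fin m) n) → T (refines F g) →
  ∀ x y → T (sameBlock F x y) → lookup g x ≡ lookup g y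
refines⁻ F g t x y s
  with Equivalence.to (T-∨ {not (sameBlock F x y)}) (all⁻ _ (all⁻ _ t (∈-allFin x)) (∈-allFin y))
... | inj₁ h = ⊥-elim (T-not⁻ h s)
... | inj₂ e = ==⇒≡ e

refines⁺ : (F : Rel n) (g : Vec (Fin m) n) →
  (∀ x y → T (sameBlock F x y) → lookup g x ≡ lookup g y) → T (refines F g)
refines⁺ {n} F g h = all⁺ (λ x → all (λ y → not (sameBlock F x y) ∨ (lookup g x == lookup g y)) (allFin n)) (allFin n)
  λ {x} _ → all⁺ (λ y → not (sameBlock F x y) ∨ (lookup g x == lookup g y)) (allFin n) λ {y} _ → implies x y (sameBlock F x y) refl
  where
  implies : ∀ x y b → sameBlock F x y ≡ b → T (not b ∨ (lookup g x == lookup g y))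
  implies x y false e = tt
  implies x y true  e = ≡⇒== (h x y (subst T (sym e) tt))

face-same : ∀ s (g : Vec (Fin m) n) x y → lookup g x ≡ lookup g y → T (signed s (face g) x y)
face-same true  g x y e rewrite e = ℕ.≤⇒≤ᵇ (ℕ.≤-refl {toℕ (lookup g y)})
face-same false g x y e rewrite e = ℕ.≤⇒≤ᵇ (ℕ.≤-refl {toℕ (lookup g y)})

same-face : ∀ s (g : Vec (Fin m) n) x y → T (signed s (face g) x y) → T (signed s (face g) y x) →
  lookup g x ≡ lookup g y
same-face true  g x y p q = toℕ-injective (ℕ.≤-antisym (ℕ.≤ᵇ⇒≤ _ _ p) (ℕ.≤ᵇ⇒≤ _ _ q))
same-face false g x y p q = toℕ-injective (ℕ.≤-antisym (ℕ.≤ᵇ⇒≤ _ _ q) (ℕ.≤ᵇ⇒≤ _ _ p))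

-- Elements tied in `F` lie in one block of `g`, where the face of `g` relates them both ways under
-- either sign; the tie-break changes nothing.
⊙-absorb : ∀ s (F : Rel n) (g : Vec (Fin m) n) → T (refines F g) → F ⊙ signed s (face g) ≐ F
⊙-absorb s F g t x y with F x y | F y x | refines⁻ F g t x y
... | false | _     | _ = refl
... | true  | false | _ = refl
... | true  | true  | h = T-ext (λ _ → tt) (λ _ → face-same s g x y (h tt))

sameBlock-⊙⁻ : (F G : Rel n) → ∀ x y → T (sameBlock (F ⊙ G) x y) → T (sameBlock F x y) × T (G x y) × T (G y x)
sameBlock-⊙⁻ F G x y t with F x y | F y x
... | true | true = tt , T-∧⁻ t
... | true | false = ⊥-elim (proj₂ (T-∧⁻ {true} t))

sameBlock-⊙⁺ : (F G : Rel n) → ∀ x y → T (sameBlock F x y) → T (G x y) → T (G y x) → T (sameBlock (F ⊙ G) x y)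
sameBlock-⊙⁺ F G x y t p q with F x y | F y x
... | true | true = T-∧⁺ p q

-- All that is needed of the preorder F; sameBlock is symmetric anyway.
record IsFace (F : Rel n) : Set where
  field
    sameBlock-refl  : ∀ x → T (sameBlock F x x)
    sameBlock-trans : ∀ x y z → T (sameBlock F x y) → T (sameBlock F y z) → T (sameBlock F x z)

open IsFace

oneBlock-isFace : IsFace {n} oneBlock
oneBlock-isFace = record { sameBlock-refl = λ _ → tt ; sameBlock-trans = λ _ _ _ _ _ → tt }

⊙-isFace : ∀ s (F : Rel n) (g : Vec (Fin m) n) → IsFace F → IsFace (F ⊙ signed s (face g))
⊙-isFace s F g isF = record
  { sameBlock-refl = λ x → merge x x (sameBlock-refl isF x) refl
  ; sameBlock-trans = λ x y z p q →
      let (p₁ , p₂ , p₃) = sameBlock-⊙⁻ F (signed s (face g)) x y p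
          (q₁ , q₂ , q₃) = sameBlock-⊙⁻ F (signed s (face g)) y z q
      in merge x z (sameBlock-trans isF x y z p₁ q₁)
           (trans (same-face s g x y p₂ p₃) (same-face s g y z q₂ q₃)) }
  where
  merge : ∀ x y → T (sameBlock F x y) → lookup g x ≡ lookup g y → T (sameBlock (F ⊙ signed s (face g)) x y)
  merge x y t e = sameBlock-⊙⁺ F (signed s (face g)) x y t (face-same s g x y e) (face-same s g y x (sym e))

coarsenings : List ℕ → Rel n → ℕ
coarsenings α F = count (refines F) (facesOfType _ α)

-- The product refines `F`, so every coarsening of `F` survives, and it refines `g` as well, which
-- was not a coarsening of `F`.
coarsenings-⊙ : ∀ α s (F : Rel n) {g} → g ∈ facesOfType n α → ¬ T (refines F g) →
  coarsenings α F < coarsenings α (F ⊙ signed s (face g))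
coarsenings-⊙ α s F {g} g∈ ¬r = count-strict
  (λ h t → refines⁺ (F ⊙ G) h λ x y b → refines⁻ F h t x y (proj₁ (sameBlock-⊙⁻ F G x y b)))
  g∈
  (refines⁺ (F ⊙ G) g λ x y b → let (_ , p , q) = sameBlock-⊙⁻ F G x y b in same-face s g x y p q)
  ¬r
  where
  G = signed s (face g)

-- Realising a face as an element of `Σₙ`

record Classes (E : Fin n → Fin n → Bool) : Set where
  field
    size       : ℕ
    size≤      : size ≤ n
    class      : Vec (Fin size) n
    surjective : ∀ j → ∃ λ i → lookup class i ≡ j
    sound      : ∀ x y → T (E x y) → lookup class x ≡ lookup class y
    complete   : ∀ x y → lookup class x ≡ lookup class y → T (E x y)

classes : (E : Fin n → Fin n → Bool) → (∀ x → T (E x x)) → (∀ x y → T (E x y) → T (E y x)) →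
  (∀ x y z → T (E x y) → T (E y z) → T (E x z)) → Classes E
classes {zero} E r s t = record
  { size = 0 ; size≤ = z≤n ; class = Vec.[] ; surjective = λ () ; sound = λ () ; complete = λ () }
classes {suc n} E r s t
  with classes (λ x y → E (suc x) (suc y)) (r ∘ suc) (λ x y → s (suc x) (suc y)) (λ x y z → t (suc x) (suc y) (suc z))
     | any? (λ i → T? (E zero (suc i)))
... | c | yes (i , e) = record
  { size = size ; size≤ = ℕ.m≤n⇒m≤1+n size≤ ; class = lookup class i Vec.∷ class
  ; surjective = λ j → let (k , h) = surjective j in suc k , h
  ; sound = snd ; complete = cmp }
  where
  open Classes c
  f = lookup class i Vec.∷ class
  snd : ∀ x y → T (E x y) → lookup f x ≡ lookup f y
  snd zero    zero    h = refl
  snd zero    (suc y) h = sound i y (t _ _ _ (s _ _ e) h)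
  snd (suc x) zero    h = sound x i (t _ _ _ h e)
  snd (suc x) (suc y) h = sound x y h
  cmp : ∀ x y → lookup f x ≡ lookup f y → T (E x y)
  cmp zero    zero    h = r zero
  cmp zero    (suc y) h = t _ _ _ e (complete i y h)
  cmp (suc x) zero    h = t _ _ _ (complete x i h) (s _ _ e)
  cmp (suc x) (suc y) h = complete x y h
-- Unrelated to all others, the new element opens class `zero` and the existing class numbers shift
-- up by one.
... | c | no ¬e = record
  { size = suc size ; size≤ = s≤s size≤ ; class = f
  ; surjective = sur ; sound = snd ; complete = cmp }
  where
  open Classes c
  f = zero Vec.∷ Vec.map suc class
  f-suc : ∀ x → lookup f (suc x) ≡ suc (lookup class x)
  f-suc x = Vec.lookup-map x suc class
  sur : ∀ j → ∃ λ i → lookup f i ≡ j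
  sur zero    = zero , refl
  sur (suc j) = let (k , h) = surjective j in suc k , trans (f-suc k) (cong suc h)
  snd : ∀ x y → T (E x y) → lookup f x ≡ lookup f y
  snd zero    zero    h = refl
  snd zero    (suc y) h = ⊥-elim (¬e (y , h))
  snd (suc x) zero    h = ⊥-elim (¬e (x , s _ _ h))
  snd (suc x) (suc y) h = trans (f-suc x) (trans (cong suc (sound x y h)) (sym (f-suc y)))
  cmp : ∀ x y → lookup f x ≡ lookup f y → T (E x y)
  cmp zero    zero    h = r zero
  cmp zero    (suc y) h with () ← trans h (f-suc y)
  cmp (suc x) zero    h with () ← trans (sym h) (f-suc x)
  cmp (suc x) (suc y) h = complete x y (suc-injective (trans (sym (f-suc x)) (trans h (f-suc y))))

∈-Σₙ : (f : Vec (Fin m) n) → m ≤ n → (∀ j → ∃ λ i → lookup f i ≡ j) → (m , f) ∈ Σₙ n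
∈-Σₙ {m} {n} f m≤n sur = ∈-concatMap⁺ _ (lose (∈-upTo⁺ (s≤s m≤n)) (∈-map⁺ (m ,_)
  (∈-filter⁺ _ (allVecs-complete ∈-allFin f) (all⁺ _ (allFin m) λ {j} _ →
    let (i , e) = sur j in any⁺ (j ==_) (lookup-∈ f i) (≡⇒== (sym e))))))

-- The count sees `F` only through `sameBlock`, so any numbering of the blocks of `F`, in whatever
-- order, gives a set composition with the same value of `nα`.
coarsenings-∈ : ∀ α (F : Rel n) → IsFace F → coarsenings α F ≢ 0 → coarsenings α F ∈ nonzeroValues n α
coarsenings-∈ {n} α F isF ≢0 = subst (_∈ nonzeroValues n α) nα≡ (∈-filter⁺ _
  (∈-deduplicate⁺ ℕ._≟_ (∈-map⁺ (λ G → nα α (proj₂ G)) (∈-Σₙ class size≤ surjective)))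
  (T-not⁺ λ t → ≢0 (trans (sym nα≡) (ℕ.≡ᵇ⇒≡ _ 0 t))))
  where
  blocks-of-F : Classes (sameBlock F)
  blocks-of-F = classes (sameBlock F) (sameBlock-refl isF) (sameBlock-sym F) (sameBlock-trans isF)
  open Classes blocks-of-F
  refines≡ : ∀ g → refinesᵇ class g ≡ refines F g
  refines≡ g = cong and (map-cong (λ x → cong and (map-cong (λ y →
    cong (λ b → not b ∨ (lookup g x == lookup g y))
      (T-ext (λ t → complete x y (==⇒≡ t)) (λ t → ≡⇒== (sound x y t)))) (allFin n))) (allFin n))
  nα≡ : nα α class ≡ coarsenings α F
  nα≡ = trans (count-cong (λ g → cong (_∧ listEqᵇ (typeOf g) α) (refines≡ g)) (allVecs (allFin (length α)) n))
    (sym (count-filter (refines F) (λ g → listEqᵇ (typeOf g) α) (allVecs (allFin (length α)) n)))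

-- Finite sums in a commutative ring

module Sums {c ℓ : Level} (R : CommutativeRing c ℓ) where
  open CommutativeRing R renaming (refl to ≈-refl; sym to ≈-sym; trans to ≈-trans)
  open Algebra.Properties.CommutativeSemigroup +-commutativeSemigroup
    using () renaming (interchange to +-interchange; x∙yz≈y∙xz to x+[y+z]≈y+[x+z])

  private variable
    x y : Level
    X : Set x
    Z : Set y

  Σᴸ : List X → (X → Carrier) → Carrier
  Σᴸ []       f = 0#
  Σᴸ (x ∷ xs) f = f x + Σᴸ xs f

  Σᴸ-cong-∈ : (xs : List X) {f g : X → Carrier} → (∀ {x} → x ∈ xs → f x ≈ g x) → Σᴸ xs f ≈ Σᴸ xs g
  Σᴸ-cong-∈ []       h = ≈-refl
  Σᴸ-cong-∈ (x ∷ xs) h = +-cong (h (here refl)) (Σᴸ-cong-∈ xs (h ∘ there))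

  Σᴸ-cong : (xs : List X) {f g : X → Carrier} → (∀ x → f x ≈ g x) → Σᴸ xs f ≈ Σᴸ xs g
  Σᴸ-cong xs h = Σᴸ-cong-∈ xs λ {x} _ → h x

  Σᴸ-zero : (xs : List X) → Σᴸ xs (λ _ → 0#) ≈ 0#
  Σᴸ-zero []       = ≈-refl
  Σᴸ-zero (x ∷ xs) = ≈-trans (+-identityˡ _) (Σᴸ-zero xs)

  Σᴸ-+ : (xs : List X) (f g : X → Carrier) → Σᴸ xs (λ x → f x + g x) ≈ Σᴸ xs f + Σᴸ xs g
  Σᴸ-+ []       f g = ≈-sym (+-identityˡ 0#)
  Σᴸ-+ (x ∷ xs) f g = ≈-trans (+-congˡ (Σᴸ-+ xs f g)) (+-interchange _ _ _ _)

  Σᴸ-*ˡ : (xs : List X) (k : Carrier) (f : X → Carrier) → Σᴸ xs (λ x → k * f x) ≈ k * Σᴸ xs f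
  Σᴸ-*ˡ []       k f = ≈-sym (zeroʳ k)
  Σᴸ-*ˡ (x ∷ xs) k f = ≈-trans (+-congˡ (Σᴸ-*ˡ xs k f)) (≈-sym (distribˡ k _ _))

  Σᴸ-++ : (xs ys : List X) (f : X → Carrier) → Σᴸ (xs ++ ys) f ≈ Σᴸ xs f + Σᴸ ys f
  Σᴸ-++ []       ys f = ≈-sym (+-identityˡ _)
  Σᴸ-++ (x ∷ xs) ys f = ≈-trans (+-congˡ (Σᴸ-++ xs ys f)) (≈-sym (+-assoc _ _ _))

  Σᴸ-map : (xs : List X) (h : X → Z) (f : Z → Carrier) → Σᴸ (map h xs) f ≡ Σᴸ xs (f ∘ h)
  Σᴸ-map []       h f = refl
  Σᴸ-map (x ∷ xs) h f = cong (f (h x) +_) (Σᴸ-map xs h f)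

  Σᴸ-concatMap : (xs : List X) (h : X → List Z) (f : Z → Carrier) →
    Σᴸ (concatMap h xs) f ≈ Σᴸ xs (λ x → Σᴸ (h x) f)
  Σᴸ-concatMap []       h f = ≈-refl
  Σᴸ-concatMap (x ∷ xs) h f = ≈-trans (Σᴸ-++ (h x) _ f) (+-congˡ (Σᴸ-concatMap xs h f))

  Σᴸ-swap : (xs : List X) (ys : List Z) (f : X → Z → Carrier) →
    Σᴸ xs (λ x → Σᴸ ys (f x)) ≈ Σᴸ ys (λ y → Σᴸ xs (λ x → f x y))
  Σᴸ-swap []       ys f = ≈-sym (Σᴸ-zero ys)
  Σᴸ-swap (x ∷ xs) ys f = ≈-trans (+-congˡ (Σᴸ-swap xs ys f)) (≈-sym (Σᴸ-+ ys _ _))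

  Σᴸ-↭ : {xs ys : List X} (f : X → Carrier) → xs ↭ ys → Σᴸ xs f ≈ Σᴸ ys f
  Σᴸ-↭ f Perm.refl         = ≈-refl
  Σᴸ-↭ f (Perm.prep x p)   = +-congˡ (Σᴸ-↭ f p)
  Σᴸ-↭ f (Perm.swap x y p) = ≈-trans (+-congˡ (+-congˡ (Σᴸ-↭ f p))) (x+[y+z]≈y+[x+z] _ _ _)
  Σᴸ-↭ f (Perm.trans p q)  = ≈-trans (Σᴸ-↭ f p) (Σᴸ-↭ f q)

-- The operator `Y` on functions of signed faces and its triangularity

module FaceOperators {c ℓ : Level} (R : CommutativeRing c ℓ) (n : ℕ) (α : List ℕ) where
  open CommutativeRing R renaming (refl to ≈-refl; sym to ≈-sym; trans to ≈-trans)
  open GroupAlgebra R n using (natR)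
  open Sums R
  open Algebra.Properties.CommutativeSemigroup +-commutativeSemigroup using () renaming (interchange to +-interchange)
  open Algebra.Properties.CommutativeSemigroup *-commutativeSemigroup using () renaming (x∙yz≈y∙xz to x*[y*z]≈y*[x*z])
  open Algebra.Properties.Ring ring using (-‿distribˡ-*)
  open Relation.Binary.Reasoning.Setoid setoid

  Fun : Set c
  Fun = Rel n → Bool → Carrier

  infix 4 _≈ᶠ_
  _≈ᶠ_ : Fun → Fun → Set ℓ
  f ≈ᶠ g = ∀ F s → f F s ≈ g F s

  ≈ᶠ-trans : ∀ {f g h} → f ≈ᶠ g → g ≈ᶠ h → f ≈ᶠ h
  ≈ᶠ-trans p q F s = ≈-trans (p F s) (q F s)

  Extensional : Fun → Set ℓ
  Extensional f = ∀ {F G} → F ≐ G → ∀ s → f F s ≈ f G s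

  -- Right multiplication of the signed face (F , s) by Σ_g (g , -), dually on functions of (F , s).
  Y : Fun → Fun
  Y f F s = Σᴸ (facesOfType n α) λ g → f (F ⊙ signed s (face g)) (not s)

  Y+ : Carrier → Fun → Fun
  Y+ k f F s = Y f F s + k * f F s

  Y²-_² : ℕ → Fun → Fun
  Y²- k ² = Y+ (- natR k) ∘ Y+ (natR k)

  -- The head of the list acts first, in step with multiplying `z` on the right by the factors from
  -- left to right.
  ∏ : List ℕ → Fun → Fun
  ∏ []       f = f
  ∏ (k ∷ ks) f = ∏ ks ((Y²- k ²) f)

  Y-cong : ∀ {f g} → f ≈ᶠ g → Y f ≈ᶠ Y g
  Y-cong h F s = Σᴸ-cong (facesOfType n α) λ g → h _ _

  Y+-cong : ∀ k {f g} → f ≈ᶠ g → Y+ k f ≈ᶠ Y+ k g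
  Y+-cong k h F s = +-cong (Y-cong h F s) (*-congˡ (h F s))

  ∏-cong : ∀ ks {f g} → f ≈ᶠ g → ∏ ks f ≈ᶠ ∏ ks g
  ∏-cong []       h = h
  ∏-cong (k ∷ ks) h = ∏-cong ks (Y+-cong (- natR k) (Y+-cong (natR k) h))

  Y-ext : ∀ {f} → Extensional f → Extensional (Y f)
  Y-ext e h s = Σᴸ-cong (facesOfType n α) λ g → e (⊙-congˡ (signed s (face g)) h) (not s)

  Y+-ext : ∀ k {f} → Extensional f → Extensional (Y+ k f)
  Y+-ext k e h s = +-cong (Y-ext e h s) (*-congˡ (e h s))

  ∏-ext : ∀ ks {f} → Extensional f → Extensional (∏ ks f)
  ∏-ext []       e = e
  ∏-ext (k ∷ ks) e = ∏-ext ks (Y+-ext (- natR k) (Y+-ext (natR k) e))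

  Y-Y+ : ∀ k f → Y (Y+ k f) ≈ᶠ Y+ k (Y f)
  Y-Y+ k f F s = ≈-trans (Σᴸ-+ (facesOfType n α) _ _) (+-congˡ (Σᴸ-*ˡ (facesOfType n α) k _))

  Y+-comm : ∀ k l f → Y+ k (Y+ l f) ≈ᶠ Y+ l (Y+ k f)
  Y+-comm k l f F s = begin
    Y (Y+ l f) F s + k * (Y f F s + l * f F s)
      ≈⟨ +-cong (Y-Y+ l f F s) (distribˡ k _ _) ⟩
    (Y (Y f) F s + l * Y f F s) + (k * Y f F s + k * (l * f F s))
      ≈⟨ +-interchange _ _ _ _ ⟩
    (Y (Y f) F s + k * Y f F s) + (l * Y f F s + k * (l * f F s))
      ≈⟨ +-cong (≈-sym (Y-Y+ k f F s)) (+-congˡ (x*[y*z]≈y*[x*z] k l _)) ⟩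
    Y (Y+ k f) F s + (l * Y f F s + l * (k * f F s))
      ≈⟨ +-congˡ (≈-sym (distribˡ l _ _)) ⟩
    Y (Y+ k f) F s + l * (Y f F s + k * f F s) ∎

  Y-∏ : ∀ ks f → ∏ ks (Y f) ≈ᶠ Y (∏ ks f)
  Y-∏ []       f F s = ≈-refl
  Y-∏ (k ∷ ks) f = ≈ᶠ-trans
    (∏-cong ks λ F s → ≈-sym (≈-trans (Y-Y+ (- natR k) (Y+ (natR k) f) F s) (Y+-cong (- natR k) (Y-Y+ (natR k) f) F s)))
    (Y-∏ ks _)

  ∏-Y+ : ∀ ks k f → ∏ ks (Y+ k f) ≈ᶠ Y+ k (∏ ks f)
  ∏-Y+ []       k f F s = ≈-refl
  ∏-Y+ (l ∷ ks) k f = ≈ᶠ-trans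
    (∏-cong ks (≈ᶠ-trans (Y+-cong _ (Y+-comm _ k f)) (Y+-comm _ k _)))
    (∏-Y+ ks k _)

  ∏-front : ∀ ks k ls f → ∏ (ks ++ k ∷ ls) f ≈ᶠ (Y²- k ²) (∏ (ks ++ ls) f)
  ∏-front []       k ls f = ≈ᶠ-trans (∏-Y+ ls _ _) (Y+-cong _ (∏-Y+ ls _ f))
  ∏-front (l ∷ ks) k ls f = ∏-front ks k ls _

  VanishesAbove : Rel n → Fun → Set ℓ
  VanishesAbove F f = ∀ G → IsFace G → coarsenings α F < coarsenings α G → ∀ s → f G s ≈ 0#

  Σᴸ-count : ∀ {A : Set} (P : A → Bool) xs {f : A → Carrier} {v} → (∀ {x} → x ∈ xs → T (P x) → f x ≈ v) →
    (∀ {x} → x ∈ xs → ¬ T (P x) → f x ≈ 0#) → Σᴸ xs f ≈ natR (count P xs) * v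
  Σᴸ-count P []       h k = ≈-sym (zeroˡ _)
  Σᴸ-count P (x ∷ xs) {f} {v} h k with P x in eq
  ... | true  = begin
    f x + Σᴸ xs f                      ≈⟨ +-cong (h (here refl) (subst T (sym eq) tt)) (Σᴸ-count P xs (h ∘ there) (k ∘ there)) ⟩
    v + natR (count P xs) * v          ≈⟨ +-congʳ (*-identityˡ v) ⟨
    1# * v + natR (count P xs) * v     ≈⟨ distribʳ v _ _ ⟨
    (1# + natR (count P xs)) * v       ∎
  ... | false = ≈-trans (+-cong (k (here refl) (subst T eq)) (Σᴸ-count P xs (h ∘ there) (k ∘ there))) (+-identityˡ _)

  -- Each `g` that `F` refines contributes `f F (not s)` by `⊙-absorb`; every other `g` leads to a
  -- face with more coarsenings, where `f` vanishes.
  Y-leading : ∀ {f} F → Extensional f → IsFace F → VanishesAbove F f → ∀ s →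
    Y f F s ≈ natR (coarsenings α F) * f F (not s)
  Y-leading F ext isF van s = Σᴸ-count (refines F) (facesOfType n α)
    (λ {g} _ r → ext (⊙-absorb s F g r) (not s))
    (λ {g} g∈ ¬r → van _ (⊙-isFace s F g isF) (coarsenings-⊙ α s F g∈ ¬r) (not s))

  Y+-vanishesAbove : ∀ k {f} F → Extensional f → VanishesAbove F f → VanishesAbove F (Y+ k f)
  Y+-vanishesAbove k F ext van G isG F<G s = ≈-trans (+-cong
    (≈-trans (Y-leading G ext isG (λ H isH G<H → van H isH (ℕ.<-trans F<G G<H)) s)
           (≈-trans (*-congˡ (van G isG F<G (not s))) (zeroʳ _)))
    (≈-trans (*-congˡ (van G isG F<G s)) (zeroʳ _))) (+-identityˡ 0#)

  -- At `F` the operator `Y` is `κ` times the sign swap. Hence `g = Y f + κ f` takes the same value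
  -- at both signs, and on such a function `Y` agrees with multiplication by `κ`.
  Y²-kills : ∀ {f} F → Extensional f → IsFace F → VanishesAbove F f → ∀ s →
    (Y²- coarsenings α F ²) f F s ≈ 0#
  Y²-kills {f} F ext isF van s = begin
    Y g F s + - κ * g F s
      ≈⟨ +-cong (Y-leading F (Y+-ext κ ext) isF (Y+-vanishesAbove κ F ext van) s)
                (≈-sym (-‿distribˡ-* κ _)) ⟩
    κ * g F (not s) + - (κ * g F s) ≈⟨ +-congʳ (*-congˡ symmetric) ⟩
    κ * g F s + - (κ * g F s)    ≈⟨ -‿inverseʳ _ ⟩
    0#                           ∎
    where
    κ = natR (coarsenings α F)
    g = Y+ κ f
    symmetric : g F (not s) ≈ g F s
    symmetric = begin
      Y f F (not s) + κ * f F (not s)            ≈⟨ +-congʳ (Y-leading F ext isF van (not s)) ⟩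
      κ * f F (not (not s)) + κ * f F (not s)    ≈⟨ +-comm _ _ ⟩
      κ * f F (not s) + κ * f F (not (not s))
        ≈⟨ +-cong (≈-sym (Y-leading F ext isF van s))
                  (*-congˡ (reflexive (cong (f F) (not-involutive s)))) ⟩
      Y f F s + κ * f F s                        ∎

  private
    total = length (facesOfType n α)

  -- Downward induction on the number of coarsenings; d bounds the number of levels above F.
  ∏-vanishes : ∀ d ks {f} F → total < coarsenings α F ℕ.+ d → Extensional f → IsFace F →
    (∀ (G : Rel n) → IsFace G → coarsenings α F ≤ coarsenings α G → coarsenings α G ∈ ks) →
    ∀ s → ∏ ks f F s ≈ 0#
  ∏-vanishes zero ks F bound ext isF vals s =
    ⊥-elim (ℕ.<⇒≱ bound (ℕ.≤-trans (ℕ.≤-reflexive (ℕ.+-identityʳ _)) (length-filter _ (facesOfType n α))))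
  ∏-vanishes (suc d) ks {f} F bound ext isF vals s with ∈-∃++ {v = coarsenings α F} (vals F isF ℕ.≤-refl)
  -- The factor belonging to `F` is made the last to act. The product of the others then has to
  -- vanish at the faces above `F` only, and the values of those are larger, so they remain in the
  -- list.
  ... | ls , ms , refl = ≈-trans (∏-front ls _ ms f F s)
    (Y²-kills F (∏-ext (ls ++ ms) ext) isF
      (λ G isG F<G → ∏-vanishes d (ls ++ ms) G
        (ℕ.<-≤-trans bound (ℕ.≤-trans (ℕ.≤-reflexive (ℕ.+-suc _ d)) (ℕ.+-monoˡ-≤ d F<G))) ext isG
        (λ H isH G≤H → others (ℕ.<-≤-trans F<G G≤H) (vals H isH (ℕ.≤-trans (ℕ.<⇒≤ F<G) G≤H)))) s)
    where
    others : ∀ {k l} → k < l → l ∈ ls ++ k ∷ ms → l ∈ ls ++ ms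
    others k<l h with ∈-++⁻ ls h
    ... | inj₁ p = ∈-++⁺ˡ p
    ... | inj₂ (here refl) = ⊥-elim (ℕ.<-irrefl refl k<l)
    ... | inj₂ (there p) = ∈-++⁺ʳ ls p

  -- All levels from a nonzero one upwards are nonzero, so their values belong to the list. The
  -- bound `suc total` is large enough for any starting level.
  ∏-nonzeroValues : ∀ {f} F → Extensional f → IsFace F → coarsenings α F ≢ 0 → ∀ s →
    ∏ (nonzeroValues n α) f F s ≈ 0#
  ∏-nonzeroValues F ext isF ≢0 = ∏-vanishes (suc total) (nonzeroValues n α) F (ℕ.m≤n+m _ _) ext isF
    (λ G isG F≤G → coarsenings-∈ α G isG λ e → ≢0 (ℕ.n≤0⇒n≡0 (ℕ.≤-trans F≤G (ℕ.≤-reflexive e))))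

  -- The additional `Y` settles the value 0. Above `F` the count is positive and the product
  -- vanishes, so `Y` multiplies the value at `F` by the count of `F`: either this is 0, or the
  -- product vanishes at `F` too.
  ∏-Y-vanishes : ∀ {f} F → Extensional f → IsFace F → ∀ s → ∏ (nonzeroValues n α) (Y f) F s ≈ 0#
  ∏-Y-vanishes {f} F ext isF s = ≈-trans (Y-∏ ks f F s) (≈-trans
    (Y-leading F (∏-ext ks ext) isF
      (λ G isG F<G → ∏-nonzeroValues G ext isG λ e → ℕ.<⇒≱ F<G (ℕ.≤-trans (ℕ.≤-reflexive e) ℕ.z≤n)) s)
    last)
    where
    ks = nonzeroValues n α
    last : natR (coarsenings α F) * ∏ ks f F (not s) ≈ 0#
    last with coarsenings α F ℕ.≟ 0
    ... | yes e rewrite e = zeroˡ _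
    ... | no ≢0 = ≈-trans (*-congˡ (∏-nonzeroValues F ext isF ≢0 (not s))) (zeroʳ _)

-- From the group algebra to the operator `Y`

module Action {c ℓ : Level} (R : CommutativeRing c ℓ) (α : List ℕ) where
  private
    N = sum α
  open CommutativeRing R renaming (refl to ≈-refl; sym to ≈-sym; trans to ≈-trans)
  open GroupAlgebra R N
  open Sums R
  open FaceOperators R N α
  open Algebra.Properties.CommutativeSemigroup *-commutativeSemigroup using () renaming (x∙yz≈y∙xz to x*[y*z]≈y*[x*z])
  open Relation.Binary.Reasoning.Setoid setoid

  ⟨_,_⟩ : KS → (Word N → Carrier) → Carrier
  ⟨ x , φ ⟩ = Σᴸ x λ p → proj₁ p * φ (proj₂ p)

  ⟨⟩-congʳ : ∀ x {φ ψ} → (∀ w → φ w ≈ ψ w) → ⟨ x , φ ⟩ ≈ ⟨ x , ψ ⟩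
  ⟨⟩-congʳ x h = Σᴸ-cong x λ p → *-congˡ (h (proj₂ p))

  ⟨⟩-* : ∀ x y φ → ⟨ x *ᴷ y , φ ⟩ ≈ ⟨ x , (λ u → ⟨ y , (λ v → φ (u ∘ₚ v)) ⟩) ⟩
  ⟨⟩-* x y φ = ≈-trans (Σᴸ-concatMap x _ _) (Σᴸ-cong x λ p →
    ≈-trans (reflexive (Σᴸ-map y _ _)) (≈-trans (Σᴸ-cong y λ q → *-assoc _ _ _) (Σᴸ-*ˡ y (proj₁ p) _)))

  -- `KS` admits arbitrary words, while `decode-ord` and `hat-chamber` speak of permutations; the
  -- support is therefore tracked through all products.
  OnPerms : KS → Set c
  OnPerms = All (IsPerm ∘ proj₂)

  *-onPerms : ∀ {x y} → OnPerms x → OnPerms y → OnPerms (x *ᴷ y)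
  *-onPerms {x} {y} hx hy = All.concat⁺ (All.map⁺ (All.map {P = IsPerm ∘ proj₂} (λ {p} → row p) hx))
    where
    row : ∀ (p : Carrier × Word N) → IsPerm (proj₂ p) →
      OnPerms (map (λ q → (proj₁ p * proj₁ q , proj₂ p ∘ₚ proj₂ q)) y)
    row p u-inj = All.map⁺ (All.map {P = IsPerm ∘ proj₂} {Q = λ q → IsPerm (proj₂ p ∘ₚ proj₂ q)}
      (λ {q} v-inj → ∘ₚ-injective (proj₂ p) (proj₂ q) u-inj v-inj) hy)

  w₀B-onPerms : OnPerms (w₀B α)
  w₀B-onPerms = *-onPerms {⟦ w₀ N ⟧} (w₀-injective ∷ []) (All.map⁺ (All.tabulate λ w∈ → proj₁ (∈-desPerms⁻ α w∈)))

  ⟨w₀B⟩ : ∀ φ → ⟨ w₀B α , φ ⟩ ≈ Σᴸ (desPerms N α) (λ w → φ (w₀ N ∘ₚ w))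
  ⟨w₀B⟩ φ = begin
    ⟨ w₀B α , φ ⟩                              ≈⟨ ⟨⟩-* ⟦ w₀ N ⟧ (B α) φ ⟩
    1# * ⟨ B α , (λ w → φ (w₀ N ∘ₚ w)) ⟩ + 0#  ≈⟨ ≈-trans (+-identityʳ _) (*-identityˡ _) ⟩
    ⟨ B α , (λ w → φ (w₀ N ∘ₚ w)) ⟩            ≡⟨ Σᴸ-map (desPerms N α) _ _ ⟩
    Σᴸ (desPerms N α) (λ w → 1# * φ (w₀ N ∘ₚ w)) ≈⟨ Σᴸ-cong (desPerms N α) (λ w → *-identityˡ _) ⟩
    Σᴸ (desPerms N α) (λ w → φ (w₀ N ∘ₚ w))    ∎

  module _ (φ : Rel N → Carrier) (φ-ext : ∀ {F G} → F ≐ G → φ F ≈ φ G) where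

    -- The linear extension to `z` of evaluating `φ` at the product of `F` with the chamber of `w`,
    -- reversed when `s` is `false`.
    hat : KS → Fun
    hat z F s = ⟨ z , (λ w → φ (F ⊙ signed s (ord w))) ⟩

    hat-ext : ∀ z → Extensional (hat z)
    hat-ext z h s = ⟨⟩-congʳ z λ w → φ-ext (⊙-congˡ (signed s (ord w)) h)

    hat-assoc : ∀ z x y → hat (z *ᴷ (x *ᴷ y)) ≈ᶠ hat ((z *ᴷ x) *ᴷ y)
    hat-assoc z x y F s = begin
      ⟨ z *ᴷ (x *ᴷ y) , ψ ⟩
        ≈⟨ ⟨⟩-* z (x *ᴷ y) ψ ⟩
      ⟨ z , (λ u → ⟨ x *ᴷ y , (λ v → ψ (u ∘ₚ v)) ⟩) ⟩
        ≈⟨ ⟨⟩-congʳ z (λ u → ⟨⟩-* x y _) ⟩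
      ⟨ z , (λ u → ⟨ x , (λ v → ⟨ y , (λ w → ψ (u ∘ₚ (v ∘ₚ w))) ⟩) ⟩) ⟩
        ≈⟨ ⟨⟩-congʳ z (λ u → ⟨⟩-congʳ x λ v → ⟨⟩-congʳ y λ w → reflexive (cong ψ (∘ₚ-assoc u v w))) ⟩
      ⟨ z , (λ u → ⟨ x , (λ v → ⟨ y , (λ w → ψ ((u ∘ₚ v) ∘ₚ w)) ⟩) ⟩) ⟩
        ≈⟨ ⟨⟩-* z x _ ⟨
      ⟨ z *ᴷ x , (λ v → ⟨ y , (λ w → ψ (v ∘ₚ w)) ⟩) ⟩
        ≈⟨ ⟨⟩-* (z *ᴷ x) y ψ ⟨
      ⟨ (z *ᴷ x) *ᴷ y , ψ ⟩ ∎
      where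
      ψ : Word N → Carrier
      ψ w = φ (F ⊙ signed s (ord w))

    hat-identityˡ : ∀ x → hat (1ᴷ *ᴷ x) ≈ᶠ hat x
    hat-identityˡ x F s = ≈-trans (⟨⟩-* 1ᴷ x _) (≈-trans (+-identityʳ _) (≈-trans (*-identityˡ _)
      (⟨⟩-congʳ x λ w → reflexive (cong (λ v → φ (F ⊙ signed s (ord v))) (∘ₚ-identityˡ w)))))

    hat-scalar : ∀ z k → hat (z *ᴷ ((k , idPerm N) ∷ [])) ≈ᶠ λ F s → k * hat z F s
    hat-scalar z k F s = begin
      ⟨ z *ᴷ ((k , idPerm N) ∷ []) , ψ ⟩
        ≈⟨ ⟨⟩-* z ((k , idPerm N) ∷ []) ψ ⟩
      ⟨ z , (λ u → k * ψ (u ∘ₚ idPerm N) + 0#) ⟩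
        ≈⟨ ⟨⟩-congʳ z (λ u → ≈-trans (+-identityʳ _) (*-congˡ (reflexive (cong ψ (∘ₚ-identityʳ u))))) ⟩
      ⟨ z , (λ u → k * ψ u) ⟩
        ≈⟨ Σᴸ-cong z (λ p → x*[y*z]≈y*[x*z] _ _ _) ⟩
      Σᴸ z (λ p → k * (proj₁ p * ψ (proj₂ p)))
        ≈⟨ Σᴸ-*ˡ z k _ ⟩
      k * ⟨ z , ψ ⟩ ∎
      where
      ψ : Word N → Carrier
      ψ w = φ (F ⊙ signed s (ord w))

    hat-+ : ∀ z x y → hat (z *ᴷ (x +ᴷ y)) ≈ᶠ λ F s → hat (z *ᴷ x) F s + hat (z *ᴷ y) F s
    hat-+ z x y F s = begin
      ⟨ z *ᴷ (x ++ y) , ψ ⟩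
        ≈⟨ ⟨⟩-* z (x ++ y) ψ ⟩
      Σᴸ z (λ p → proj₁ p * ⟨ x ++ y , (λ v → ψ (proj₂ p ∘ₚ v)) ⟩)
        ≈⟨ Σᴸ-cong z (λ p → ≈-trans (*-congˡ (Σᴸ-++ x y _)) (distribˡ _ _ _)) ⟩
      Σᴸ z (λ p → proj₁ p * ⟨ x , (λ v → ψ (proj₂ p ∘ₚ v)) ⟩ + proj₁ p * ⟨ y , (λ v → ψ (proj₂ p ∘ₚ v)) ⟩)
        ≈⟨ Σᴸ-+ z _ _ ⟩
      ⟨ z , (λ u → ⟨ x , (λ v → ψ (u ∘ₚ v)) ⟩) ⟩ + ⟨ z , (λ u → ⟨ y , (λ v → ψ (u ∘ₚ v)) ⟩) ⟩
        ≈⟨ +-cong (⟨⟩-* z x ψ) (⟨⟩-* z y ψ) ⟨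
      ⟨ z *ᴷ x , ψ ⟩ + ⟨ z *ᴷ y , ψ ⟩ ∎
      where
      ψ : Word N → Carrier
      ψ w = φ (F ⊙ signed s (ord w))

    hat-chamber : ∀ u → IsPerm u → ∀ F s →
      Σᴸ (desPerms N α) (λ w → φ (F ⊙ signed s (ord (u ∘ₚ (w₀ N ∘ₚ w)))))
      ≈ Σᴸ (facesOfType N α) (λ g → φ ((F ⊙ signed s (face g)) ⊙ signed (not s) (ord u)))
    hat-chamber u u-inj F s = begin
      Σᴸ (desPerms N α) (λ w → φ (F ⊙ signed s (ord (u ∘ₚ (w₀ N ∘ₚ w)))))
        ≈⟨ Σᴸ-cong-∈ (desPerms N α) (λ {w} w∈ → φ-ext (order w w∈)) ⟩
      Σᴸ (desPerms N α) (λ w → χ (blocks α u′ u′-inj w))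
        ≡⟨ Σᴸ-map (desPerms N α) (blocks α u′ u′-inj) χ ⟨
      Σᴸ (map (blocks α u′ u′-inj) (desPerms N α)) χ
        ≈⟨ Σᴸ-↭ χ (blocks-↭ α u′ u′-inj) ⟩
      Σᴸ (facesOfType N α) χ ∎
      where
      -- The reversal is absorbed into the chamber, so that the bijection is used for `u′`; passing
      -- back from `ord u′` to `ord u` then turns `s` into `not s`.
      u′ = u ∘ₚ w₀ N
      u′-inj : IsPerm u′
      u′-inj = ∘ₚ-injective u (w₀ N) u-inj w₀-injective
      χ = λ g → φ ((F ⊙ signed s (face g)) ⊙ signed (not s) (ord u))
      order : ∀ w → w ∈ desPerms N α → F ⊙ signed s (ord (u ∘ₚ (w₀ N ∘ₚ w))) ≐
        (F ⊙ signed s (face (blocks α u′ u′-inj w))) ⊙ signed (not s) (ord u)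
      order w w∈ = ≐-trans (⊙-congʳ F inner) (≐-sym (⊙-assoc F (signed s G) (signed (not s) (ord u))))
        where
        G = face (blocks α u′ u′-inj w)
        inner : signed s (ord (u ∘ₚ (w₀ N ∘ₚ w))) ≐ signed s G ⊙ signed (not s) (ord u)
        inner rewrite ∘ₚ-assoc u (w₀ N) w =
          let (w-inj , t) = ∈-desPerms⁻ α w∈ in
          ≐-trans (signed-cong s (ord-blocks α u′ u′-inj w w-inj t))
          (≐-trans (signed-⊙ s G (ord u′))
          (⊙-congʳ (signed s G) (≐-trans (signed-cong s (ord-∘w₀ u u-inj)) (signed-flip s (ord u)))))

    hat-w₀B : ∀ {z} → OnPerms z → hat (z *ᴷ w₀B α) ≈ᶠ Y (hat z)
    hat-w₀B {z} perms F s = begin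
      ⟨ z *ᴷ w₀B α , ψ ⟩
        ≈⟨ ⟨⟩-* z (w₀B α) ψ ⟩
      ⟨ z , (λ u → ⟨ w₀B α , (λ v → ψ (u ∘ₚ v)) ⟩) ⟩
        ≈⟨ Σᴸ-cong-∈ z (λ {p} p∈ → *-congˡ (≈-trans (⟨w₀B⟩ _) (hat-chamber (proj₂ p) (All.lookup perms p∈) F s))) ⟩
      Σᴸ z (λ p → proj₁ p * Σᴸ (facesOfType N α) (λ g → χ g (proj₂ p)))
        ≈⟨ Σᴸ-cong z (λ p → Σᴸ-*ˡ (facesOfType N α) (proj₁ p) _) ⟨
      Σᴸ z (λ p → Σᴸ (facesOfType N α) (λ g → proj₁ p * χ g (proj₂ p)))
        ≈⟨ Σᴸ-swap z (facesOfType N α) _ ⟩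
      Σᴸ (facesOfType N α) (λ g → ⟨ z , χ g ⟩) ∎
      where
      ψ : Word N → Carrier
      ψ w = φ (F ⊙ signed s (ord w))
      χ = λ g u → φ ((F ⊙ signed s (face g)) ⊙ signed (not s) (ord u))

    hat-Y+ : ∀ {z} k → OnPerms z → hat (z *ᴷ (w₀B α +ᴷ ((k , idPerm N) ∷ []))) ≈ᶠ Y+ k (hat z)
    hat-Y+ {z} k perms F s =
      ≈-trans (hat-+ z (w₀B α) ((k , idPerm N) ∷ []) F s) (+-cong (hat-w₀B perms F s) (hat-scalar z k F s))

    shifted-onPerms : ∀ {z} k → OnPerms z → OnPerms (z *ᴷ (w₀B α +ᴷ ((k , idPerm N) ∷ [])))
    shifted-onPerms k perms = *-onPerms perms (All.++⁺ w₀B-onPerms (idPerm-injective ∷ []))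

    factor : ℕ → KS
    factor k = (w₀B α +ᴷ nat k) *ᴷ (w₀B α -ᴷ nat k)

    factor-onPerms : ∀ k → OnPerms (factor k)
    factor-onPerms k = shifted-onPerms (- natR k) (All.++⁺ w₀B-onPerms (idPerm-injective ∷ []))

    hat-factor : ∀ {z} k → OnPerms z → hat (z *ᴷ factor k) ≈ᶠ (Y²- k ²) (hat z)
    hat-factor {z} k perms F s = ≈-trans (hat-assoc z (w₀B α +ᴷ nat k) (w₀B α -ᴷ nat k) F s)
      -- Subtracting `nat k` computes to appending the identity with coefficient `- natR k`, so
      -- `hat-Y+` covers both halves of the factor.
      (≈-trans (hat-Y+ (- natR k) (shifted-onPerms (natR k) perms) F s)
             (Y+-cong (- natR k) (hat-Y+ (natR k) perms) F s))

    hat-prod : ∀ ks {z} → OnPerms z → hat (z *ᴷ prodᴷ (map factor ks)) ≈ᶠ ∏ ks (hat z)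
    hat-prod [] {z} perms F s = ≈-trans (hat-scalar z 1# F s) (*-identityˡ _)
    hat-prod (k ∷ ks) {z} perms F s = ≈-trans (hat-assoc z (factor k) (prodᴷ (map factor ks)) F s)
      (≈-trans (hat-prod ks (*-onPerms perms (factor-onPerms k)) F s) (∏-cong ks (hat-factor k perms) F s))

    prod-onPerms : ∀ ks → OnPerms (prodᴷ (map factor ks))
    prod-onPerms []       = idPerm-injective ∷ []
    prod-onPerms (k ∷ ks) = *-onPerms (factor-onPerms k) (prod-onPerms ks)

    theoremLHS-onPerms : OnPerms (theoremLHS α)
    theoremLHS-onPerms = *-onPerms w₀B-onPerms (prod-onPerms (nonzeroValues N α))

    hat-theoremLHS : hat (theoremLHS α) oneBlock true ≈ 0#
    hat-theoremLHS = begin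
      hat (w₀B α *ᴷ prodᴷ (map factor ks)) oneBlock true ≈⟨ hat-prod ks w₀B-onPerms oneBlock true ⟩
      ∏ ks (hat (w₀B α)) oneBlock true
        -- Reading `w₀B α` as `1ᴷ *ᴷ w₀B α` exhibits the leading factor as one more application of
        -- `Y`, the one that `∏-Y-vanishes` requires.
        ≈⟨ ∏-cong ks (λ F s → ≈-trans (≈-sym (hat-identityˡ (w₀B α) F s))
                                      (hat-w₀B {1ᴷ} (idPerm-injective ∷ []) F s)) oneBlock true ⟩
      ∏ ks (Y (hat 1ᴷ)) oneBlock true                    ≈⟨ ∏-Y-vanishes oneBlock (hat-ext 1ᴷ) oneBlock-isFace true ⟩
      0#                                                 ∎
      where
      ks = nonzeroValues N α

  -- The coefficient at `v` as a function of the linear order; going through `decode` defines it on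
  -- all relations and makes it respect `≐`.
  δ : Word N → Rel N → Carrier
  δ v F = if vecEqᵇ (decode F) v then 1# else 0#

  δ-ext : ∀ v {F G} → F ≐ G → δ v F ≈ δ v G
  δ-ext v h = reflexive (cong (λ w → if vecEqᵇ w v then 1# else 0#) (decode-cong h))

  coeff-pairing : ∀ {x} → OnPerms x → ∀ v → coeff x v ≈ ⟨ x , δ v ∘ ord ⟩
  coeff-pairing []       v = ≈-refl
  coeff-pairing {(k , w) ∷ x} (w-inj ∷ perms) v = +-cong term (coeff-pairing perms v)
    where
    term : (if vecEqᵇ w v then k else 0#) ≈ k * δ v (ord w)
    term rewrite decode-ord w w-inj with vecEqᵇ w v
    ... | true  = ≈-sym (*-identityʳ k)
    ... | false = ≈-sym (zeroʳ k)

theorem5p7 : {c ℓ : Level} (R : CommutativeRing c ℓ) (n : ℕ) (α : List ℕ) →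
    IsComposition n α →
    GroupAlgebra._≈ᴷ_ R n (GroupAlgebra.theoremLHS R n α) (GroupAlgebra.0ᴷ R n)
theorem5p7 R n α (_ , refl) v = ≈-trans
  (coeff-pairing (theoremLHS-onPerms (δ v) (δ-ext v)) v)
  -- `oneBlock ⊙ signed true (ord w)` computes to `ord w`, so `hat` at `oneBlock` and `true` is
  -- exactly the pairing of `coeff-pairing`.
  (hat-theoremLHS (δ v) (δ-ext v))
  where
  open CommutativeRing R renaming (refl to ≈-refl; sym to ≈-sym; trans to ≈-trans)
  open Action R α
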